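{- Let $X$ be an $n$-premaniplex and let $\xi:\Pi(X)\to\Gamma$ be a voltage assignment such that the derived graph $X^\xi$ is a maniplex and $$\xi(\Pi^{x,y}_{[0,m]}(X))\cap\xi(\Pi^{x,y}_{[k,n-1]}(X))=\xi(\Pi^{x,y}_{[k,m]}(X))$$ for all $k,m\in\{0,\dots,n-1\}$ and all vertices $x,y$ of $X$. Then the coset poset $$\mathcal{P}(X,\xi)=\{\xi(\Pi^x(C))\tau : C\text{ is a connected component of } X_{\overline i}\text{ for some } i\in\{0,\dots,n-1\},\ x=f(C),\ \tau\in\Gamma\},$$ with the order given in the context, is an abstract $n$-polytope on which $\Gamma$ acts (by right multiplication on cosets) with symmetry type graph $X$, i.e. $\mathcal{T}(\mathcal{P}(X,\xi),\Gamma)\cong X$.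
   Context: **Polytopes.** A poset is flagged if it has a least and a greatest element and all its maximal chains (flags) have the same finite cardinality, say $n+2$; it then has an order-preserving rank function onto $\{ -1,0,\dots,n\}$. Two flags are $i$-adjacent if they differ exactly in their element of rank $i$. An (abstract) $n$-polytope is a flagged poset with rank function onto $\{ -1,\dots,n\}$ such that (diamond condition) for each flag $\Phi$ and each $i\in\{0,\dots,n-1\}$ there is a unique flag $\Phi^i$ that is $i$-adjacent to $\Phi$; and (strong flag connectedness) any two flags $\Phi,\Psi$ are joined by a sequence of flags, consecutive ones adjacent, all containing $\Phi\cap\Psi$. **Graphs.** Graphs may have parallel edges and semi-edges. Every edge consists of darts; a dart $d$ has an initial vertex, a terminal vertex and an inverse dart $d^{ -1}$; an edge joining two different vertices (a link) consists of two mutually inverse darts, and a semi-edge consists of a single dart $d=d^{ -1}$ with both ends at the same vertex. An $n$-premaniplex is a connected graph with edges coloured by $\{0,\dots,n-1\}$, all of whose edges are links or semi-edges, such that each vertex is incident to exactly one edge of each colour, and such that if $|i-j|>1$ every path of length $4$ alternating between colours $i$ and $j$ is closed. An $n$-maniplex is an $n$-regular connected simple graph (no semi-edges, no parallel edges) with a proper edge colouring with colours $\{0,\dots,n-1\}$ such that if $|i-j|>1$ the subgraph formed by edges of colours $i,j$ is a disjoint union of $4$-cycles. **Symmetry type graph.** For a polytope $\mathcal{P}$ and $G\le\Gamma(\mathcal{P})$ (automorphism group), the symmetry type graph $\mathcal{T}(\mathcal{P},G)$ has the $G$-orbits of flags as vertices; for each flag $\Phi$ and colour $i$ there is an edge of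 colour $i$ joining the orbit of $\Phi$ to that of $\Phi^i$ (a semi-edge if these orbits coincide), so that each vertex has exactly one edge of each colour. Isomorphisms of premaniplexes preserve edge colours. **Voltages.** A voltage assignment $\xi:\Pi(X)\to\Gamma$ into a group $\Gamma$ is a groupoid antimorphism from the fundamental groupoid of $X$; equivalently, it assigns to each dart $d$ an element $\xi(d)\in\Gamma$ with $\xi(d^{ -1})=\xi(d)^{ -1}$ and is extended to paths by $\xi(d_1d_2\cdots d_k)=\xi(d_k)\cdots\xi(d_1)$ (empty paths have trivial voltage). The derived graph $X^\xi$ has vertex set $V\times\Gamma$ and dart set $D\times\Gamma$ ($V$, $D$ the vertices and darts of $X$); the dart $(d,g)$, where $d$ goes from $x$ to $y$, goes from $(x,g)$ to $(y,\xi(d)g)$, has inverse $(d^{ -1},\xi(d)g)$ and has the colour of $d$. For vertices $x,y$ and a set of colours $I$, $\xi(\Pi_I^{x,y}(X))$ is the set of voltages of paths from $x$ to $y$ using only darts with colours in $I$, and $\xi(\Pi_I^x(X))=\xi(\Pi_I^{x,x}(X))$, a subgroup of $\Gamma$. $[a,b]$ denotes $\{a,a+1,\dots,b\}$ (empty if $a>b$). **The coset poset $\mathcal{P}(X,\xi)$.** Write $\overline{i}=\{0,\dots,n-1\}\setminus\{i\}$; $X_{\overline i}$ is the graph obtained from $X$ by deleting the edges of colour $i$, and $X_{\overline i}(y)$ is its connected component containing $y$. Let $f$ be a choice function assigning to every connected subgraph $C$ of $X$ a base vertex $f(C)\in C$. For a component $C$ of $X_{\overline i}$ and $x=f(C)$,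 $\xi(\Pi^x(C))=\xi(\Pi^x_{\overline i}(X))$ is the group of voltages of closed paths in $C$ based at $x$. The elements of rank $i\in\{0,\dots,n-1\}$ are the right cosets $\xi(\Pi^x_{\overline i}(X))\gamma$, $\gamma\in\Gamma$, where $x=f(C)$ and $C$ runs over the components of $X_{\overline i}$; they are regarded as formal copies, i.e. as triples consisting of $i$, $C$ and the coset, so that elements with different $i$ or different $C$ are different. For each vertex $y$ of $X$ and each $i$, fix a path $W^y_i$ inside $X_{\overline i}(y)$ from $f(X_{\overline i}(y))$ to $y$, and set $\alpha_i^y=\xi(W_i^y)$. For $i<j$, components $C$ of $X_{\overline i}$ and $C'$ of $X_{\overline j}$ with base vertices $x=f(C)$, $x'=f(C')$, and $\gamma,\gamma'\in\Gamma$, put $\xi(\Pi^x_{\overline i}(X))\gamma<\xi(\Pi^{x'}_{\overline j}(X))\gamma'$ if and only if $\alpha_i^y\,\xi(\Pi^x_{\overline i}(X))\gamma\cap\alpha_j^y\,\xi(\Pi^{x'}_{\overline j}(X))\gamma'\neq\emptyset$ for some vertex $y\in C\cap C'$. A least element (rank $-1$) and a greatest element (rank $n$) are adjoined. -}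

module Defs where

open import Level using (Level; _⊔_; suc)
open import Algebra.Bundles using (Group)
import Algebra.Properties.Group as GroupProperties
open import Data.Fin.Base using (Fin; toℕ; inject₁; punchOut; _<_; _≤_)
  renaming (suc to fsuc)
open import Data.Fin.Induction using (<-weakInduction)
open import Data.Fin.Patterns using (0F; 1F; 2F; 3F)
import Data.Fin.Properties as Fin
open import Data.List.Base using (List; []; _∷_)
open import Data.List.Relation.Unary.All using (All)
open import Data.Nat.Base as ℕ using (ℕ; ∣_-_∣)
import Data.Nat.Properties as ℕ
open import Data.Product.Base using (Σ; ∃; _×_; _,_; proj₁; proj₂)
open import Data.Product.Relation.Binary.Pointwise.NonDependent using (×-setoid)
open import Data.Product using (∃!)
open import Data.Sum.Base using (_⊎_; inj₁; inj₂)
open import Function.Base using (_∘_; _on_)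
open import Function.Bundles using (_⇔_; mk⇔; Equivalence; Bijection)
open import Function.Definitions using (Bijective; Injective; Surjective)
open import Relation.Binary.Bundles using (Setoid)
open import Relation.Binary.Bundles.Raw using (RawRelation)
open import Relation.Binary.Core using (Rel)
open import Relation.Binary.Definitions using (Minimum; Maximum; _Respects_)
open import Relation.Binary.Morphism.Structures using (IsOrderIsomorphism)
open import Relation.Binary.PropositionalEquality.Core
  using (_≡_; _≢_; refl; sym; trans; cong; subst; subst₂)
import Relation.Binary.PropositionalEquality.Properties as ≡
open import Relation.Binary.Structures using (IsEquivalence; IsPartialOrder)
import Relation.Binary.Construct.Add.Extrema.Equality as AddEquality
import Relation.Binary.Construct.Add.Extrema.NonStrict as AddOrder
import Relation.Binary.Construct.StrictToNonStrict as NonStrict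
open import Relation.Nullary.Construct.Add.Extrema using (_±; ⊥±; [_]; ⊤±)
open import Relation.Nullary.Decidable.Core using (yes; no)
open import Relation.Nullary.Negation.Core using (¬_; contradiction)
open import Relation.Unary using (Pred; _∈_; _⊆_; _≐_; _∩_; _≬_)
open import Relation.Unary.Properties using (≐-refl; ≐-sym; ≐-trans)

private
  variable
    n : ℕ
    a v ℓv d ℓd v′ ℓv′ d′ ℓd′ c ℓ ℓ₁ ℓ₂ : Level

------------------------------------------------------------------------
-- Graphs

-- Vertices and darts form setoids because both the derived graph (whose
-- vertices involve elements of a group) and the symmetry type graph (whose
-- vertices are orbits) are quotients.  An edge is a class {d, inv d}, so a
-- colouring of the edges is an inv-invariant colouring of the darts.
record ColouredGraph (n : ℕ) (v ℓv d ℓd : Level) : Set (suc (v ⊔ ℓv ⊔ d ⊔ ℓd)) where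
  field
    vertexSetoid : Setoid v ℓv
    dartSetoid   : Setoid d ℓd

  open Setoid vertexSetoid public
    using () renaming (Carrier to Vertex; _≈_ to _≈ᵥ_)
  open Setoid dartSetoid public
    using () renaming (Carrier to Dart; _≈_ to _≈ᵈ_)

  field
    init term : Dart → Vertex
    inv       : Dart → Dart
    colour    : Dart → Fin n

    init-cong      : ∀ {d e} → d ≈ᵈ e → init d ≈ᵥ init e
    term-cong      : ∀ {d e} → d ≈ᵈ e → term d ≈ᵥ term e
    inv-cong       : ∀ {d e} → d ≈ᵈ e → inv d ≈ᵈ inv e
    colour-cong    : ∀ {d e} → d ≈ᵈ e → colour d ≡ colour e
    inv-involutive : ∀ d → inv (inv d) ≈ᵈ d
    init-inv       : ∀ d → init (inv d) ≈ᵥ term d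
    colour-inv     : ∀ d → colour (inv d) ≡ colour d

  IsLink IsSemiEdge : Dart → Set _
  IsLink d     = ¬ init d ≈ᵥ term d
  IsSemiEdge d = inv d ≈ᵈ d

  SameEdge : Rel Dart ℓd
  SameEdge d e = d ≈ᵈ e ⊎ d ≈ᵈ inv e

  data Path : Vertex → Vertex → Set (v ⊔ ℓv ⊔ d) where
    stop : ∀ {x y} → x ≈ᵥ y → Path x y
    step : ∀ {x y} (d : Dart) → x ≈ᵥ init d → Path (term d) y → Path x y

  colours : ∀ {x y} → Path x y → List (Fin n)
  colours (stop _)     = []
  colours (step d _ p) = colour d ∷ colours p

  IsConnected : Set (v ⊔ ℓv ⊔ d)
  IsConnected = Vertex × (∀ x y → Path x y)

module _ (X : ColouredGraph n v ℓv d ℓd) where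
  open ColouredGraph X

  -- Vertices joined to y by a path with colours in I, i.e. the vertex set of
  -- the component of y in the subgraph formed by the edges with colours in I.
  Component : Pred (Fin n) a → Vertex → Pred Vertex (a ⊔ v ⊔ ℓv ⊔ d)
  Component I y z = ∃ λ (p : Path y z) → All I (colours p)

  record IsPremaniplex : Set (v ⊔ ℓv ⊔ d ⊔ ℓd) where
    field
      connected        : IsConnected
      linksOrSemiEdges : ∀ d → IsLink d ⊎ IsSemiEdge d
      edgeOfColour     : ∀ x i → ∃ λ d → init d ≈ᵥ x × colour d ≡ i
      uniqueOfColour   : ∀ {d e} → init d ≈ᵥ init e → colour d ≡ colour e → SameEdge d e
      alternatingClosed : ∀ {i j} → ∣ toℕ i - toℕ j ∣ ℕ.> 1 →
                          ∀ {x y} (p : Path x y) →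
                          colours p ≡ i ∷ j ∷ i ∷ j ∷ [] → x ≈ᵥ y

  next : Fin 4 → Fin 4
  next 0F = 1F
  next 1F = 2F
  next 2F = 3F
  next 3F = 0F

  -- The component of x in the subgraph of edges of colours i and j is a 4-cycle:
  -- the edges of the cycle through x are the only ones of these colours
  -- incident to its vertices.
  record IsFourCycle (i j : Fin n) (x : Vertex) : Set (v ⊔ ℓv ⊔ d ⊔ ℓd) where
    field
      dart     : Fin 4 → Dart
      coloured : ∀ k → colour (dart k) ≡ i ⊎ colour (dart k) ≡ j
      cyclic   : ∀ k → term (dart k) ≈ᵥ init (dart (next k))
      distinct : ∀ {k l} → init (dart k) ≈ᵥ init (dart l) → k ≡ l
      start    : init (dart 0F) ≈ᵥ x
      complete : ∀ {e k} → init e ≈ᵥ init (dart k) →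
                 colour e ≡ i ⊎ colour e ≡ j → ∃ λ l → SameEdge e (dart l)

  -- In a simple graph the edges at x correspond to the darts starting at x.
  DartAt : Vertex → Set (ℓv ⊔ d)
  DartAt x = ∃ λ d → init d ≈ᵥ x

  record IsManiplex : Set (v ⊔ ℓv ⊔ d ⊔ ℓd) where
    field
      connected     : IsConnected
      links         : ∀ d → IsLink d
      noParallel    : ∀ {d e} → init d ≈ᵥ init e → term d ≈ᵥ term e → SameEdge d e
      regular       : ∀ x → ∃ λ (f : Fin n → DartAt x) → Bijective _≡_ (_≈ᵈ_ on proj₁) f
      proper        : ∀ {d e} → init d ≈ᵥ init e → colour d ≡ colour e → SameEdge d e
      fourCycles    : ∀ {i j} → ∣ toℕ i - toℕ j ∣ ℕ.> 1 → ∀ x → IsFourCycle i j x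

record _≅_ (X : ColouredGraph n v ℓv d ℓd) (Y : ColouredGraph n v′ ℓv′ d′ ℓd′)
       : Set (v ⊔ ℓv ⊔ d ⊔ ℓd ⊔ v′ ⊔ ℓv′ ⊔ d′ ⊔ ℓd′) where
  private
    module X = ColouredGraph X
    module Y = ColouredGraph Y
  field
    onVertices : Bijection X.vertexSetoid Y.vertexSetoid
    onDarts    : Bijection X.dartSetoid Y.dartSetoid
  private
    f = Bijection.to onVertices
    g = Bijection.to onDarts
  field
    preserves-init   : ∀ d → Y.init (g d) Y.≈ᵥ f (X.init d)
    preserves-term   : ∀ d → Y.term (g d) Y.≈ᵥ f (X.term d)
    preserves-inv    : ∀ d → Y.inv (g d) Y.≈ᵈ g (X.inv d)
    preserves-colour : ∀ d → Y.colour (g d) ≡ X.colour d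

------------------------------------------------------------------------
-- Voltages

interval : ℕ → ℕ → Pred (Fin n) Level.zero
interval k m i = k ℕ.≤ toℕ i × toℕ i ℕ.≤ m

module _ (X : ColouredGraph n v ℓv d ℓd) (Γ : Group c ℓ) where
  open ColouredGraph X
  private module Γ = Group Γ
  open Γ using (_≈_; _∙_; ε; _⁻¹)

  record VoltageAssignment : Set (d ⊔ ℓd ⊔ c ⊔ ℓ) where
    field
      ξ      : Dart → Γ.Carrier
      ξ-cong : ∀ {d e} → d ≈ᵈ e → ξ d ≈ ξ e
      ξ-inv  : ∀ d → ξ (inv d) ≈ ξ d ⁻¹

    voltage : ∀ {x y} → Path x y → Γ.Carrier
    voltage (stop _)     = ε
    voltage (step d _ p) = voltage p ∙ ξ d

    Voltages : Pred (Fin n) a → Vertex → Vertex → Pred Γ.Carrier (a ⊔ v ⊔ ℓv ⊔ d ⊔ ℓ)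
    Voltages I x y γ = ∃ λ (p : Path x y) → All I (colours p) × voltage p ≈ γ

module _ {X : ColouredGraph n v ℓv d ℓd} {Γ : Group c ℓ} (V : VoltageAssignment X Γ) where
  open ColouredGraph X
  open VoltageAssignment V
  open Group Γ using (_≈_; _∙_; ∙-cong; ∙-congʳ)
  private
    module Γ = Group Γ

    back : ∀ d γ → ξ (inv d) ∙ (ξ d ∙ γ) ≈ γ
    back d γ = Γ.trans (∙-congʳ (ξ-inv d)) (GroupProperties.\\-leftDividesʳ Γ (ξ d) γ)

  derivedGraph : ColouredGraph n (v ⊔ c) (ℓv ⊔ ℓ) (d ⊔ c) (ℓd ⊔ ℓ)
  derivedGraph = record
    { vertexSetoid   = ×-setoid vertexSetoid Γ.setoid
    ; dartSetoid     = ×-setoid dartSetoid Γ.setoid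
    ; init           = λ (d , γ) → init d , γ
    ; term           = λ (d , γ) → term d , ξ d ∙ γ
    ; inv            = λ (d , γ) → inv d , ξ d ∙ γ
    ; colour         = λ (d , γ) → colour d
    ; init-cong      = λ (p , q) → init-cong p , q
    ; term-cong      = λ (p , q) → term-cong p , ∙-cong (ξ-cong p) q
    ; inv-cong       = λ (p , q) → inv-cong p , ∙-cong (ξ-cong p) q
    ; colour-cong    = λ (p , q) → colour-cong p
    ; inv-involutive = λ (d , γ) → inv-involutive d , back d γ
    ; init-inv       = λ (d , γ) → init-inv d , Γ.refl
    ; colour-inv     = λ (d , γ) → colour-inv d
    }

------------------------------------------------------------------------
-- Polytopes

-- The order is a bare relation, being a partial order is part of being a
-- polytope.  Subsets are predicates valued in the universe of _≈_, which
-- contains all finite subsets; with excluded middle the choice of universe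
-- is immaterial.
module Flags (P : RawRelation c ℓ₁ ℓ₂) where
  open RawRelation P using (Carrier; _≈_) renaming (_∼_ to _≤ₚ_)

  record IsChain (C : Pred Carrier ℓ₁) : Set (c ⊔ ℓ₁ ⊔ ℓ₂) where
    field
      respects   : C Respects _≈_
      comparable : ∀ {x y} → x ∈ C → y ∈ C → x ≤ₚ y ⊎ y ≤ₚ x

  record Flag : Set (c ⊔ suc ℓ₁ ⊔ ℓ₂) where
    field
      elements : Pred Carrier ℓ₁
      isChain  : IsChain elements
      maximal  : ∀ (C : Pred Carrier ℓ₁) → IsChain C → elements ⊆ C → C ⊆ elements
    open IsChain isChain public

  open Flag public using (elements)

  _≈ᶠ_ : Rel Flag (c ⊔ ℓ₁)
  Φ ≈ᶠ Ψ = elements Φ ≐ elements Ψ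

  HasCardinality : ℕ → Pred Carrier ℓ₁ → Set (c ⊔ ℓ₁)
  HasCardinality m C = ∃ λ (f : Fin m → ∃ C) → Bijective _≡_ (_≈_ on proj₁) f

  record IsFlagged (n : ℕ) : Set (c ⊔ suc ℓ₁ ⊔ ℓ₂) where
    field
      least       : ∃ (Minimum _≤ₚ_)
      greatest    : ∃ (Maximum _≤ₚ_)
      cardinality : ∀ (Φ : Flag) → HasCardinality (2 ℕ.+ n) (elements Φ)

  -- The ranks -1, …, n are encoded as 0, …, n+1.  On a flagged poset there
  -- is at most one function that is strictly order preserving.
  record IsRankFunction (n : ℕ) (rank : Carrier → Fin (2 ℕ.+ n)) : Set (c ⊔ ℓ₁ ⊔ ℓ₂) where
    field
      rank-cong : ∀ {x y} → x ≈ y → rank x ≡ rank y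
      rank-mono : ∀ {x y} → x ≤ₚ y → ¬ x ≈ y → rank x < rank y
      rank-onto : Surjective _≈_ _≡_ rank

  properRank : Fin n → Fin (2 ℕ.+ n)
  properRank i = fsuc (inject₁ i)

  module _ (rank : Carrier → Fin (2 ℕ.+ n)) where

    Adjacent : Fin n → Rel Flag (c ⊔ ℓ₁)
    Adjacent i Φ Ψ = ∀ {x y} → x ∈ elements Φ → y ∈ elements Ψ → rank x ≡ rank y →
                     x ≈ y ⇔ rank x ≢ properRank i

    data Joined (S : Pred Carrier ℓ₁) : Rel Flag (c ⊔ suc ℓ₁ ⊔ ℓ₂) where
      stop : ∀ {Φ Ψ} → S ⊆ elements Φ → Φ ≈ᶠ Ψ → Joined S Φ Ψ
      step : ∀ {Φ Φ′ Ψ} i → S ⊆ elements Φ → Adjacent i Φ Φ′ → Joined S Φ′ Ψ → Joined S Φ Ψ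

record IsPolytope (n : ℕ) (P : RawRelation c ℓ₁ ℓ₂) : Set (c ⊔ suc ℓ₁ ⊔ ℓ₂) where
  open RawRelation P using (Carrier; _≈_) renaming (_∼_ to _≤ₚ_)
  open Flags P
  field
    isPartialOrder          : IsPartialOrder _≈_ _≤ₚ_
    isFlagged               : IsFlagged n
    rank                    : Carrier → Fin (2 ℕ.+ n)
    isRankFunction          : IsRankFunction n rank
    diamond                 : ∀ Φ i → ∃! _≈ᶠ_ (Adjacent rank i Φ)
    stronglyFlagConnected   : ∀ Φ Ψ → Joined rank (elements Φ ∩ elements Ψ) Φ Ψ

-- G acts on the right by automorphisms, and faithfully, i.e. G is identified
-- with a subgroup of the automorphism group of P.
record IsAutomorphismGroup (G : Group a ℓ) (P : RawRelation c ℓ₁ ℓ₂)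
                           (_·_ : RawRelation.Carrier P → Group.Carrier G → RawRelation.Carrier P)
                           : Set (a ⊔ ℓ ⊔ c ⊔ ℓ₁ ⊔ ℓ₂) where
  open RawRelation P using (_≈_) renaming (_∼_ to _≤ₚ_)
  private module G = Group G
  field
    isAutomorphism : ∀ g → IsOrderIsomorphism _≈_ _≈_ _≤ₚ_ _≤ₚ_ (_· g)
    ·-congˡ        : ∀ {x g h} → g G.≈ h → (x · g) ≈ (x · h)
    ·-identity     : ∀ x → (x · G.ε) ≈ x
    ·-assoc        : ∀ x g h → (x · (g G.∙ h)) ≈ ((x · g) · h)
    faithful       : ∀ {g} → (∀ x → (x · g) ≈ x) → g G.≈ G.ε

------------------------------------------------------------------------
-- Uniqueness of strictly monotone rankings of a finite chain

private

  injective⇒surjective : ∀ {m} {f : Fin m → Fin m} → Injective _≡_ _≡_ f →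
                         ∀ j → ∃ λ i → f i ≡ j
  injective⇒surjective {ℕ.suc m} {f} inj j with Fin.any? (λ i → f i Fin.≟ j)
  ... | yes hit = hit
  ... | no miss = contradiction (Fin.injective⇒≤ squeezed) ℕ.1+n≰n
    where
    avoids : ∀ i → j ≢ f i
    avoids i eq = miss (i , sym eq)

    squeezed : Injective _≡_ _≡_ (λ i → punchOut (avoids i))
    squeezed {i} {k} = inj ∘ Fin.punchOut-injective (avoids i) (avoids k)

  strictMono⇒expanding : ∀ {m} (h : Fin m → Fin m) → (∀ {i j} → i < j → h i < h j) →
                         ∀ i → i ≤ h i
  strictMono⇒expanding {ℕ.suc m} h mono =
    <-weakInduction (λ i → i ≤ h i) ℕ.z≤n λ i ih →
      ℕ.≤-<-trans (subst (ℕ._≤ toℕ (h (inject₁ i))) (Fin.toℕ-inject₁ i) ih)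
                  (mono (ℕ.s≤s (ℕ.≤-reflexive (Fin.toℕ-inject₁ i))))

  rankings-≤ : ∀ {m} {r s : Fin m → Fin m} → Injective _≡_ _≡_ r →
               (∀ {k l} → r k < r l → s k < s l) → ∀ k → r k ≤ s k
  rankings-≤ {r = r} {s} inj r⇒s k =
    subst (λ k′ → r k ≤ s k′) (inj (section-right (r k)))
          (strictMono⇒expanding (s ∘ section) mono (r k))
    where
    section = proj₁ ∘ injective⇒surjective inj
    section-right = proj₂ ∘ injective⇒surjective inj

    mono : ∀ {i j} → i < j → s (section i) < s (section j)
    mono {i} {j} i<j = r⇒s (subst₂ _<_ (sym (section-right i)) (sym (section-right j)) i<j)

------------------------------------------------------------------------
-- Symmetry type graphs

module _ {P : RawRelation c ℓ₁ ℓ₂} (polytope : IsPolytope n P)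
         {G : Group a ℓ} {_·_ : RawRelation.Carrier P → Group.Carrier G → RawRelation.Carrier P}
         (action : IsAutomorphismGroup G P _·_) where

  open RawRelation P using (Carrier; _≈_) renaming (_∼_ to _≤ₚ_)
  open Flags P
  open IsPolytope polytope
  open IsFlagged isFlagged using (cardinality)
  open IsRankFunction isRankFunction
  open IsAutomorphismGroup action
  private
    module G = Group G
    module P = IsPartialOrder isPartialOrder
    module Aut g = IsOrderIsomorphism (isAutomorphism g)
    open P using (module Eq)

    cancelʳ : ∀ x g → ((x · g) · (g G.⁻¹)) ≈ x
    cancelʳ x g =
      Eq.trans (Eq.sym (·-assoc x g (g G.⁻¹))) (Eq.trans (·-congˡ (G.inverseʳ g)) (·-identity x))

    cancelˡ : ∀ x g → ((x · (g G.⁻¹)) · g) ≈ x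
    cancelˡ x g =
      Eq.trans (Eq.sym (·-assoc x (g G.⁻¹) g)) (Eq.trans (·-congˡ (G.inverseˡ g)) (·-identity x))

    StrictMono : (Carrier → Fin (2 ℕ.+ n)) → Set _
    StrictMono ρ = ∀ {x y} → x ≤ₚ y → ¬ x ≈ y → ρ x < ρ y

    module _ (Φ : Flag) where
      private
        enum = proj₁ (cardinality Φ)
        enum-injective = proj₁ (proj₂ (cardinality Φ))
        enum-surjective = proj₂ (proj₂ (cardinality Φ))

        nth : Fin (2 ℕ.+ n) → Carrier
        nth k = proj₁ (enum k)

        nth-comparable : ∀ k l → nth k ≤ₚ nth l ⊎ nth l ≤ₚ nth k
        nth-comparable k l = Flag.comparable Φ (proj₂ (enum k)) (proj₂ (enum l))

        nth-distinct : ∀ {k l} → k ≢ l → ¬ nth k ≈ nth l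
        nth-distinct k≢l = k≢l ∘ enum-injective

        ρ∘nth-injective : ∀ {ρ} → StrictMono ρ → Injective _≡_ _≡_ (ρ ∘ nth)
        ρ∘nth-injective mono {k} {l} eq with k Fin.≟ l
        ... | yes k≡l = k≡l
        ... | no k≢l with nth-comparable k l
        ...   | inj₁ k≤l = contradiction eq (Fin.<⇒≢ (mono k≤l (nth-distinct k≢l)))
        ...   | inj₂ l≤k = contradiction (sym eq) (Fin.<⇒≢ (mono l≤k (nth-distinct (k≢l ∘ sym))))

        same-order : ∀ {ρ σ} → StrictMono ρ → StrictMono σ →
                     ∀ {k l} → ρ (nth k) < ρ (nth l) → σ (nth k) < σ (nth l)
        same-order {ρ} ρ-mono σ-mono {k} {l} lt with nth-comparable k l
        ... | inj₁ k≤l = σ-mono k≤l (nth-distinct λ k≡l → Fin.<⇒≢ lt (cong (ρ ∘ nth) k≡l))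
        ... | inj₂ l≤k = contradiction
          (ρ-mono l≤k (nth-distinct λ l≡k → Fin.<⇒≢ lt (cong (ρ ∘ nth) (sym l≡k))))
          (Fin.<-asym lt)

      rank-unique : ∀ {ρ} → StrictMono ρ → (∀ {x y} → x ≈ y → ρ x ≡ ρ y) →
                    ∀ {x} → x ∈ elements Φ → ρ x ≡ rank x
      rank-unique {ρ} ρ-mono ρ-cong {x} x∈Φ =
        trans (ρ-cong x≈) (trans at-nth (sym (rank-cong x≈)))
        where
        k = proj₁ (enum-surjective (x , x∈Φ))

        x≈ : x ≈ nth k
        x≈ = Eq.sym (proj₂ (enum-surjective (x , x∈Φ)) refl)

        at-nth : ρ (nth k) ≡ rank (nth k)
        at-nth = Fin.≤-antisym
          (rankings-≤ (ρ∘nth-injective ρ-mono) (same-order ρ-mono rank-mono) k)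
          (rankings-≤ (ρ∘nth-injective rank-mono) (same-order rank-mono ρ-mono) k)

    rank-invariant : ∀ (Φ : Flag) g {x} → x ∈ elements Φ → rank (x · g) ≡ rank x
    rank-invariant Φ g = rank-unique Φ
      (λ x≤y x≉y → rank-mono (Aut.mono g x≤y) (x≉y ∘ Aut.injective g))
      (rank-cong ∘ Aut.cong g)

    preimage : G.Carrier → Flag → Flag
    preimage g Ψ = record
      { elements = λ x → elements Ψ (x · g)
      ; isChain  = pullback g (Flag.isChain Ψ)
      ; maximal  = λ C chain Ψg⊆C {x} x∈C →
          Flag.maximal Ψ (λ y → C (y · (g G.⁻¹))) (pullback (g G.⁻¹) chain)
            (λ {y} y∈Ψ → Ψg⊆C (Flag.respects Ψ (Eq.sym (cancelˡ y g)) y∈Ψ))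
            (IsChain.respects chain (Eq.sym (cancelʳ x g)) x∈C)
      }
      where
      pullback : ∀ h {C} → IsChain C → IsChain (λ x → C (x · h))
      pullback h chain = record
        { respects   = IsChain.respects chain ∘ Aut.cong h
        ; comparable = λ x∈C y∈C → comparable-cancel (IsChain.comparable chain x∈C y∈C)
        }
        where
        comparable-cancel : ∀ {x y} → (x · h) ≤ₚ (y · h) ⊎ (y · h) ≤ₚ (x · h) → x ≤ₚ y ⊎ y ≤ₚ x
        comparable-cancel (inj₁ le) = inj₁ (Aut.cancel h le)
        comparable-cancel (inj₂ le) = inj₂ (Aut.cancel h le)

    adjacent-sym : ∀ {i Φ Ψ} → Adjacent rank i Φ Ψ → Adjacent rank i Ψ Φ
    adjacent-sym adj x∈Ψ y∈Φ eq = mk⇔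
      (λ x≈y → subst (_≢ _) (sym eq) (Equivalence.to y⇔x (Eq.sym x≈y)))
      (λ r≢i → Eq.sym (Equivalence.from y⇔x (subst (_≢ _) eq r≢i)))
      where y⇔x = adj y∈Φ x∈Ψ (sym eq)

    adjacent-preimage : ∀ {i Φ Ψ} g → Adjacent rank i Φ Ψ →
                        Adjacent rank i (preimage g Φ) (preimage g Ψ)
    adjacent-preimage {Φ = Φ} {Ψ} g adj x∈ y∈ eq = mk⇔
      (λ x≈y → subst (_≢ _) rx (Equivalence.to xg⇔yg (Aut.cong g x≈y)))
      (λ r≢i → Aut.injective g (Equivalence.from xg⇔yg (subst (_≢ _) (sym rx) r≢i)))
      where
      rx = rank-invariant (preimage g Φ) g x∈
      xg⇔yg = adj x∈ y∈ (trans rx (trans eq (sym (rank-invariant (preimage g Ψ) g y∈))))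

    flip : Fin n → Flag → Flag
    flip i Φ = proj₁ (diamond Φ i)

    flip-adjacent : ∀ i Φ → Adjacent rank i Φ (flip i Φ)
    flip-adjacent i Φ = proj₁ (proj₂ (diamond Φ i))

    flip-unique : ∀ {i Φ Ψ} → Adjacent rank i Φ Ψ → flip i Φ ≈ᶠ Ψ
    flip-unique {i} {Φ} {Ψ} adj = proj₂ (proj₂ (diamond Φ i)) {Ψ} adj

  -- Ψ is the image of Φ under some g, i.e. Φ = { x | x · g ∈ Ψ }.
  SameOrbit : Rel Flag (a ⊔ c ⊔ ℓ₁)
  SameOrbit Φ Ψ = ∃ λ g → elements Φ ≐ (λ x → elements Ψ (x · g))

  private
    ≈ᶠ⇒SameOrbit : ∀ {Φ Ψ} → Φ ≈ᶠ Ψ → SameOrbit Φ Ψ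
    ≈ᶠ⇒SameOrbit {Φ} {Ψ} (Φ⊆Ψ , Ψ⊆Φ) = G.ε ,
      (λ {x} x∈Φ → Flag.respects Ψ (Eq.sym (·-identity x)) (Φ⊆Ψ x∈Φ)) ,
      (λ {x} x∈Ψ → Ψ⊆Φ (Flag.respects Ψ (·-identity x) x∈Ψ))

    SameOrbit-isEquivalence : IsEquivalence SameOrbit
    SameOrbit-isEquivalence = record
      { refl  = λ {Φ} → ≈ᶠ⇒SameOrbit {Φ} {Φ} ≐-refl
      ; sym   = λ {Φ} {Ψ} (g , Φ⊆Ψ , Ψ⊆Φ) → (g G.⁻¹) ,
          (λ {y} y∈Ψ → Ψ⊆Φ (Flag.respects Ψ (Eq.sym (cancelˡ y g)) y∈Ψ)) ,
          (λ {y} y∈Φ → Flag.respects Ψ (cancelˡ y g) (Φ⊆Ψ y∈Φ))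
      ; trans = λ {Φ} {Ψ} {Ω} (g , Φ⊆Ψ , Ψ⊆Φ) (h , Ψ⊆Ω , Ω⊆Ψ) → (g G.∙ h) ,
          (λ {x} x∈Φ → Flag.respects Ω (Eq.sym (·-assoc x g h)) (Ψ⊆Ω (Φ⊆Ψ x∈Φ))) ,
          (λ {x} x∈Ω → Ψ⊆Φ (Ω⊆Ψ (Flag.respects Ω (·-assoc x g h) x∈Ω)))
      }

    flip-cong : ∀ i {Φ Ψ} → SameOrbit Φ Ψ → SameOrbit (flip i Φ) (flip i Ψ)
    flip-cong i {Φ} {Ψ} (g , Φ⊆Ψ , Ψ⊆Φ) = g ,
      flip-unique {i} {Φ} {preimage g (flip i Ψ)}
        (λ x∈Φ → adjacent-preimage {Φ = Ψ} {flip i Ψ} g (flip-adjacent i Ψ) (Φ⊆Ψ x∈Φ))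

  orbits : Setoid (c ⊔ suc ℓ₁ ⊔ ℓ₂) (a ⊔ c ⊔ ℓ₁)
  orbits = record { isEquivalence = SameOrbit-isEquivalence }

  -- Each orbit carries exactly one dart of each colour: (Φ , i) runs from the
  -- orbit of Φ to the orbit of the flag i-adjacent to Φ.
  symmetryTypeGraph : ColouredGraph n (c ⊔ suc ℓ₁ ⊔ ℓ₂) (a ⊔ c ⊔ ℓ₁) (c ⊔ suc ℓ₁ ⊔ ℓ₂) (a ⊔ c ⊔ ℓ₁)
  symmetryTypeGraph = record
    { vertexSetoid   = orbits
    ; dartSetoid     = ×-setoid orbits (≡.setoid (Fin n))
    ; init           = λ (Φ , i) → Φ
    ; term           = λ (Φ , i) → flip i Φ
    ; inv            = λ (Φ , i) → flip i Φ , i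
    ; colour         = λ (Φ , i) → i
    ; init-cong      = proj₁
    ; term-cong      = λ { {Φ , i} {Ψ , .i} (Φ~Ψ , refl) → flip-cong i {Φ} {Ψ} Φ~Ψ }
    ; inv-cong       = λ { {Φ , i} {Ψ , .i} (Φ~Ψ , refl) → flip-cong i {Φ} {Ψ} Φ~Ψ , refl }
    ; colour-cong    = proj₂
    ; inv-involutive = λ (Φ , i) →
        ≈ᶠ⇒SameOrbit {flip i (flip i Φ)} {Φ}
          (flip-unique {i} {flip i Φ} {Φ} (adjacent-sym {i} {Φ} {flip i Φ} (flip-adjacent i Φ))) , refl
    ; init-inv       = λ (Φ , i) → IsEquivalence.refl SameOrbit-isEquivalence {flip i Φ}
    ; colour-inv     = λ _ → refl
    }

------------------------------------------------------------------------
-- The coset poset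

avoid : Fin n → Pred (Fin n) Level.zero
avoid i j = j ≢ i

-- Components are given by any of their vertices: base i y is the base vertex
-- of the component of y in the graph without the edges of colour i.  Only
-- these connected subgraphs ever have their base vertex taken.
record BaseVertices (X : ColouredGraph n v ℓv d ℓd) : Set (v ⊔ ℓv ⊔ d) where
  open ColouredGraph X
  field
    base      : Fin n → Vertex → Vertex
    base∈     : ∀ i y → base i y ∈ Component X (avoid i) y
    base-cong : ∀ i {y z} → Component X (avoid i) y ≐ Component X (avoid i) z →
                base i y ≈ᵥ base i z

-- The choice of W i y need not respect _≈ᵥ_ in y, which only makes it more general.
record BasePaths {X : ColouredGraph n v ℓv d ℓd} (f : BaseVertices X)
                 : Set (v ⊔ ℓv ⊔ d) where
  open ColouredGraph X
  open BaseVertices f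
  field
    W       : ∀ i y → Path (base i y) y
    W-avoid : ∀ i y → All (avoid i) (colours (W i y))

module CosetPoset {X : ColouredGraph n v ℓv d ℓd} {Γ : Group c ℓ} (V : VoltageAssignment X Γ)
                  (f : BaseVertices X) (Ws : BasePaths f) where
  open ColouredGraph X
  open VoltageAssignment V
  open BaseVertices f
  open BasePaths Ws
  private module Γ = Group Γ
  open Γ using (_∙_)

  α : Fin n → Vertex → Γ.Carrier
  α i y = voltage (W i y)

  _⟨∙_ : Pred Γ.Carrier ℓ₁ → Γ.Carrier → Pred Γ.Carrier _
  (H ⟨∙ γ) δ = ∃ λ η → η ∈ H × δ Γ.≈ η ∙ γ

  _∙⟩_ : Γ.Carrier → Pred Γ.Carrier ℓ₁ → Pred Γ.Carrier _
  (γ ∙⟩ H) δ = ∃ λ η → η ∈ H × δ Γ.≈ γ ∙ η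

  -- The triple (i, C, coset), C being the component containing the given
  -- vertex and the coset being represented by the given element of Γ.
  record Element : Set (v ⊔ c) where
    constructor element
    field
      index          : Fin n
      vertex         : Vertex
      representative : Γ.Carrier

    component : Pred Vertex (v ⊔ ℓv ⊔ d)
    component = Component X (avoid index) vertex

    coset : Pred Γ.Carrier (v ⊔ ℓv ⊔ d ⊔ c ⊔ ℓ)
    coset = Voltages (avoid index) x x ⟨∙ representative
      where x = base index vertex

  open Element

  record _≈ᴱ_ (A B : Element) : Set (v ⊔ ℓv ⊔ d ⊔ c ⊔ ℓ) where
    field
      sameIndex     : index A ≡ index B
      sameComponent : component A ≐ component B
      sameCoset     : coset A ≐ coset B

  record _<ᴱ_ (A B : Element) : Set (v ⊔ ℓv ⊔ d ⊔ c ⊔ ℓ) where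
    field
      index<     : index A < index B
      common     : Vertex
      common∈    : common ∈ component A ∩ component B
      intersect  : (α (index A) common ∙⟩ coset A) ≬ (α (index B) common ∙⟩ coset B)

  cosetPoset : RawRelation (v ⊔ c) (v ⊔ ℓv ⊔ d ⊔ c ⊔ ℓ) (v ⊔ ℓv ⊔ d ⊔ c ⊔ ℓ)
  cosetPoset = record
    { Carrier = Element ±
    ; _≈_     = AddEquality._≈±_ _≈ᴱ_
    ; _∼_     = AddOrder._≤±_ (NonStrict._≤_ _≈ᴱ_ _<ᴱ_)
    }

  rightMultiplication : Element ± → Γ.Carrier → Element ±
  rightMultiplication ⊥±                δ = ⊥±
  rightMultiplication [ element i y γ ] δ = [ element i y (γ ∙ δ) ]
  rightMultiplication ⊤±                δ = ⊤±

{-# OPTIONS --safe #-}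
module Submission where

-- The vertices of the derived graph M are to be the flags of the polytope.  A
-- path in X from x to y of voltage g lifts to paths from (x , γ) to (y , gγ), so
-- a coset of rank i is the same thing as a component of M without the edges of
-- colour i, two cosets are comparable iff their components meet, and the
-- hypothesis on voltages says that vertices of M joined both by a path with
-- colours ≤ m and by one with colours ≥ k are joined by one with colours in [k , m].
--
-- Colours below i commute with colours above i, so a path avoiding colour i can
-- be sorted into a part above i followed by a part below i.  Sorting makes the
-- order transitive and shows that the elements of any chain have a common vertex
-- of M; so every flag of the poset is the set of components of some vertex.  With
-- the hypothesis, sorting also shows that two vertices which share a component for
-- each i ∈ K are joined by a path avoiding all colours in K.  Taking K to be all
-- colours, all colours but one, and the ranks of Φ ∩ Ψ respectively, this gives
-- that a vertex is determined by its flag, the diamond condition, and strong flag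
-- connectedness.  Finally Γ acts on M with the vertices of X as its orbits.

open import Defs
open import Level using (Level; _⊔_; suc)
open import Algebra.Bundles using (Group)
import Algebra.Properties.Group as GroupProperties
open import Axiom.ExcludedMiddle using (ExcludedMiddle)
open import Data.Fin.Base using (Fin; toℕ; fromℕ; fromℕ<; inject₁; _<_)
  renaming (suc to fsuc; zero to fzero)
open import Data.Fin.Patterns using (0F; 1F; 2F; 3F)
import Data.Fin.Properties as Fin
open import Data.Fin.Relation.Unary.Top using (view; ‵fromℕ; ‵inject₁)
open import Data.List.Relation.Unary.All as All using (All; []; _∷_)
open import Data.Nat.Base as ℕ using (ℕ; _∸_; ∣_-_∣)
import Data.Nat.Properties as ℕ
open import Data.Product using (∃!)
open import Data.Product.Base using (Σ; ∃; _×_; _,_; proj₁; proj₂)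
open import Data.Sum.Base using (_⊎_; inj₁; inj₂)
open import Data.Unit.Polymorphic.Base using (⊤; tt)
open import Function.Base using (_∘_; id)
open import Function.Bundles using (_⇔_; mk⇔; module Equivalence)
open import Relation.Binary.Bundles using (Setoid)
open import Relation.Binary.Bundles.Raw using (RawRelation)
open import Relation.Binary.Core using (Rel)
open import Relation.Binary.Definitions using (tri<; tri≈; tri>)
open import Relation.Binary.Morphism.Structures using (IsOrderIsomorphism)
open import Relation.Binary.PropositionalEquality.Core
  using (_≡_; _≢_; refl; sym; trans; cong; subst; subst₂)
open import Relation.Binary.Structures using (IsEquivalence; IsPartialOrder; IsStrictPartialOrder)
import Relation.Binary.Construct.Add.Extrema.Equality as AddEquality
import Relation.Binary.Construct.Add.Extrema.NonStrict as AddOrder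
import Relation.Binary.Construct.StrictToNonStrict as NonStrict
open import Relation.Nullary.Construct.Add.Extrema using (_±; ⊥±; [_]; ⊤±)
open import Relation.Nullary.Decidable.Core using (yes; no; _×-dec_)
open import Relation.Nullary.Negation.Core using (¬_; contradiction)
open import Relation.Unary using (Pred; U; _∈_; _⊆_; _∩_; _∪_; _≐_; ∁; Decidable)
open import Relation.Unary.Properties using (≐-sym; ≐-trans)
open VoltageAssignment using (Voltages)
open CosetPoset using (cosetPoset; rightMultiplication)

private
  variable
    n : ℕ
    i j κ a ℓ : Level

-- Initial and final intervals of colours.

below atLeast above : ℕ → Pred (Fin n) Level.zero
below j i   = toℕ i ℕ.< j
atLeast k i = k ℕ.≤ toℕ i
above k     = atLeast (ℕ.suc k)

-- Flag graphs

-- A properly coloured regular graph given by its involutions: `r i` crosses the edge of colour `i`,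
-- so no darts have to be compared. Fixed points are excluded only in `IsPolytopal`.
record FlagGraph (n : ℕ) (a ℓ : Level) : Set (suc (a ⊔ ℓ)) where
  field
    setoid : Setoid a ℓ

  open Setoid setoid public
    using (_≈_) renaming (Carrier to Point; refl to ≈-refl; sym to ≈-sym; trans to ≈-trans)

  field
    r            : Fin n → Point → Point
    r-cong       : ∀ i {x y} → x ≈ y → r i x ≈ r i y
    r-involutive : ∀ i x → r i (r i x) ≈ x
    r-commute    : ∀ {i j} → ∣ toℕ i - toℕ j ∣ ℕ.> 1 → ∀ x → r i (r j x) ≈ r j (r i x)

  data Reach (I : Pred (Fin n) i) : Rel Point (i ⊔ a ⊔ ℓ) where
    stop : ∀ {x y} → x ≈ y → Reach I x y
    step : ∀ {x y k} → k ∈ I → Reach I (r k x) y → Reach I x y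

  reach-respˡ : ∀ {I : Pred (Fin n) i} {x y z} → x ≈ y → Reach I y z → Reach I x z
  reach-respˡ x≈y (stop y≈z)   = stop (≈-trans x≈y y≈z)
  reach-respˡ x≈y (step k∈I p) = step k∈I (reach-respˡ (r-cong _ x≈y) p)

  reach-refl : ∀ {I : Pred (Fin n) i} {x} → Reach I x x
  reach-refl = stop ≈-refl

  reach-trans : ∀ {I : Pred (Fin n) i} {x y z} → Reach I x y → Reach I y z → Reach I x z
  reach-trans (stop x≈y)   q = reach-respˡ x≈y q
  reach-trans (step k∈I p) q = step k∈I (reach-trans p q)

  reach-respʳ : ∀ {I : Pred (Fin n) i} {x y z} → Reach I x y → y ≈ z → Reach I x z
  reach-respʳ p y≈z = reach-trans p (stop y≈z)

  reach-sym : ∀ {I : Pred (Fin n) i} {x y} → Reach I x y → Reach I y x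
  reach-sym (stop x≈y)   = stop (≈-sym x≈y)
  reach-sym (step k∈I p) = reach-trans (reach-sym p) (step k∈I (stop (r-involutive _ _)))

  reach-mono : ∀ {I : Pred (Fin n) i} {J : Pred (Fin n) j} → I ⊆ J →
               ∀ {x y} → Reach I x y → Reach J x y
  reach-mono I⊆J (stop x≈y)   = stop x≈y
  reach-mono I⊆J (step k∈I p) = step (I⊆J k∈I) (reach-mono I⊆J p)

  reach-∅ : ∀ {I : Pred (Fin n) i} → (∀ k → ¬ I k) → ∀ {x y} → Reach I x y → x ≈ y
  reach-∅ empty (stop x≈y)         = x≈y
  reach-∅ empty (step {k = k} k∈I _) = contradiction k∈I (empty k)

  reach-r : ∀ {I : Pred (Fin n) i} {k} → (∀ {l} → l ∈ I → ∣ toℕ l - toℕ k ∣ ℕ.> 1) →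
            ∀ {x y} → Reach I x y → Reach I (r k x) (r k y)
  reach-r far (stop x≈y)   = stop (r-cong _ x≈y)
  reach-r far (step l∈I p) = step l∈I (reach-respˡ (r-commute (far l∈I) _) (reach-r far p))

  -- Sorting: a first step in `J` is pushed past the `I` part of the already sorted rest, with which
  -- it commutes.
  reach-∪ : ∀ {I : Pred (Fin n) i} {J : Pred (Fin n) j} →
            (∀ {l k} → l ∈ I → k ∈ J → ∣ toℕ l - toℕ k ∣ ℕ.> 1) →
            ∀ {x y} → Reach (I ∪ J) x y → ∃ λ z → Reach I x z × Reach J z y
  reach-∪ far (stop x≈y) = _ , stop x≈y , reach-refl
  reach-∪ far (step (inj₁ k∈I) p) =
    let z , q , q′ = reach-∪ far p in z , step k∈I q , q′
  reach-∪ far (step {k = k} (inj₂ k∈J) p) =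
    let z , q , q′ = reach-∪ far p in
    r k z ,
    -- The sorted rest starts at `r k x`; applying `r k` to its `I` part moves that start back to
    -- `x`.
    reach-respˡ (≈-sym (r-involutive k _)) (reach-r (λ l∈I → far l∈I k∈J) q) ,
    step k∈J (reach-respˡ (r-involutive k z) q′)

  -- The number `m` lies strictly between the two colours.
  below-above-far : ∀ {m : ℕ} {k l : Fin n} → k ∈ above m → l ∈ below m →
                    ∣ toℕ k - toℕ l ∣ ℕ.> 1
  below-above-far m<k l<m =
    subst (1 ℕ.<_) (sym (ℕ.m≤n⇒∣n-m∣≡n∸m (ℕ.<⇒≤ (ℕ.<-trans l<m m<k))))
          (ℕ.m+n≤o⇒m≤o∸n 2 (ℕ.≤-trans (ℕ.s≤s l<m) m<k))

  avoid-split : ∀ {k : Fin n} → avoid k ⊆ above (toℕ k) ∪ below (toℕ k)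
  avoid-split {k} {l} l≢k with Fin.<-cmp l k
  ... | tri< l<k _ _ = inj₂ l<k
  ... | tri≈ _ l≡k _ = contradiction l≡k l≢k
  ... | tri> _ _ k<l = inj₁ k<l

  below⊆avoid : ∀ {m} {k : Fin n} → m ℕ.≤ toℕ k → below m ⊆ avoid k
  below⊆avoid m≤k l<m refl = ℕ.<⇒≱ l<m m≤k

  above⊆avoid : ∀ {k l : Fin n} → toℕ k ℕ.≤ toℕ l → above (toℕ l) ⊆ avoid k
  above⊆avoid k≤l l<m refl = ℕ.<⇒≱ l<m k≤l

  reach-around : ∀ {k x y} → Reach (avoid k) x y →
                 ∃ λ z → Reach (above (toℕ k)) x z × Reach (below (toℕ k)) z y
  reach-around p = reach-∪ below-above-far (reach-mono avoid-split p)

  -- The condition on voltages, read in the flag graph with half-open intervals. Bounds in `ℕ` may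
  -- lie beyond the last colour, so that inductions need no special case at the ends.
  IsIntersecting : Set (a ⊔ ℓ)
  IsIntersecting = ∀ k m {x y} → Reach (below m) x y → Reach (atLeast k) x y →
                   Reach (atLeast k ∩ below m) x y

  module _ (intersecting : IsIntersecting) {K : Pred (Fin n) κ} (K? : Decidable K) where

    -- Induction on l, which bounds the elements of K below m: if l is in K, the
    -- detour around l of the path from x to y splits off a part with colours
    -- between l and m, hence outside K.
    reach-below-∁ : ∀ l m → l ℕ.≤ m → K ∩ below m ⊆ below l → ∀ {x y} → Reach (below m) x y →
                    (∀ {k} → k ∈ K → toℕ k ℕ.< l → Reach (avoid k) x y) →
                    Reach (∁ K ∩ below m) x y
    reach-below-∁ ℕ.zero m _ bound p around =
      reach-mono (λ k<m → (λ k∈K → ℕ.n≮0 (bound (k∈K , k<m))) , k<m) p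
    reach-below-∁ (ℕ.suc l) m l<m bound {x} {y} p around
      with Fin.any? (λ k → (toℕ k ℕ.≟ l) ×-dec K? k)
    ... | no l∉K = reach-below-∁ l m (ℕ.<⇒≤ l<m)
      (λ (k∈K , k<m) → ℕ.≤∧≢⇒< (ℕ.m<1+n⇒m≤n (bound (k∈K , k<m))) (λ k≡l → l∉K (_ , k≡l , k∈K)))
      p (λ k∈K k<l → around k∈K (ℕ.m<n⇒m<1+n k<l))
    ... | yes (k , refl , k∈K) =
      -- The detour is run from `y` to `x`: `q` leaves `y` with colours above `k`, and `q′` goes on
      -- to `x` with colours below `k`.
      let z , q , q′ = reach-around (reach-sym (around k∈K ℕ.≤-refl))
          k≤m = ℕ.<⇒≤ l<m
          high = intersecting (ℕ.suc l) m
                   (reach-trans (reach-mono (λ i<k → ℕ.<-≤-trans i<k k≤m) q′) p)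
                   (reach-sym q)
          -- Recursion on the part from `x` to `z`. For a smaller element of `K` the required path
          -- goes through `y`, since `q` only uses colours above `k`.
          low = reach-below-∁ l l ℕ.≤-refl proj₂ (reach-sym q′)
                  (λ i∈K i<k → reach-trans (around i∈K (ℕ.m<n⇒m<1+n i<k))
                                           (reach-mono (above⊆avoid (ℕ.<⇒≤ i<k)) q))
      in reach-trans
           (reach-mono (λ (i∉K , i<k) → i∉K , ℕ.<-≤-trans i<k k≤m) low)
           (reach-mono
             -- By `bound`, `k` is the largest element of `K` below `m`.
             (λ (k<i , i<m) → (λ i∈K → ℕ.<⇒≱ k<i (ℕ.m<1+n⇒m≤n (bound (i∈K , i<m)))) , i<m) high)

    reach-∁ : ∀ {x y} → Reach U x y → (∀ {k} → k ∈ K → Reach (avoid k) x y) → Reach (∁ K) x y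
    reach-∁ p around = reach-mono proj₁
      (reach-below-∁ n n ℕ.≤-refl proj₂ (reach-mono (λ _ → Fin.toℕ<n _) p)
        (λ k∈K _ → around k∈K))

record IsPolytopal {n : ℕ} (M : FlagGraph n a ℓ) : Set (a ⊔ ℓ) where
  open FlagGraph M
  field
    origin       : Point
    connected    : ∀ x y → Reach U x y
    r-free       : ∀ i x → ¬ r i x ≈ x
    intersecting : IsIntersecting

-- Posets of faces

-- A ∋ x says that A is a face of the flag x, i.e. that x lies in the component
-- of the flag graph which A stands for.
record IsFacePoset {a ℓ e p : Level} {n : ℕ} (M : FlagGraph n a ℓ) {E : Set e}
                   (_≈ᴱ_ _<ᴱ_ : Rel E (e ⊔ p)) : Set (a ⊔ ℓ ⊔ suc (e ⊔ p)) where
  open FlagGraph M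
  infix 4 _∋_
  field
    index       : E → Fin n
    _∋_         : E → Point → Set (e ⊔ p)
    inhabited   : ∀ A → ∃ λ x → A ∋ x
    ∋-connected : ∀ A {x y} → A ∋ x → A ∋ y → Reach (avoid (index A)) x y
    ∋-closed    : ∀ A {x y} → A ∋ x → Reach (avoid (index A)) x y → A ∋ y
    face        : Fin n → Point → E
    index-face  : ∀ i x → index (face i x) ≡ i
    face∋       : ∀ i x → face i x ∋ x
    ≈⇔          : ∀ {A B} → A ≈ᴱ B ⇔ (index A ≡ index B × ∃ λ x → A ∋ x × B ∋ x)
    <⇔          : ∀ {A B} → A <ᴱ B ⇔ (index A < index B × ∃ λ x → A ∋ x × B ∋ x)

  ∋⇒≈ : ∀ {A B x} → index A ≡ index B → A ∋ x → B ∋ x → A ≈ᴱ B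
  ∋⇒≈ eq A∋x B∋x = Equivalence.from ≈⇔ (eq , _ , A∋x , B∋x)

  ∋⇒< : ∀ {A B x} → index A < index B → A ∋ x → B ∋ x → A <ᴱ B
  ∋⇒< lt A∋x B∋x = Equivalence.from <⇔ (lt , _ , A∋x , B∋x)

  index-cong : ∀ {A B} → A ≈ᴱ B → index A ≡ index B
  index-cong = proj₁ ∘ Equivalence.to ≈⇔

  index-mono : ∀ {A B} → A <ᴱ B → index A < index B
  index-mono = proj₁ ∘ Equivalence.to <⇔

  -- One shared point suffices: both faces are components of the graph without one and the same
  -- colour.
  ∋-resp : ∀ {A B x} → A ≈ᴱ B → A ∋ x → B ∋ x
  ∋-resp {A} {B} {x} A≈B A∋x =
    let eq , z , A∋z , B∋z = Equivalence.to ≈⇔ A≈B in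
    ∋-closed B B∋z (subst (λ i → Reach (avoid i) z x) eq (∋-connected A A∋z A∋x))

  isEquivalence : IsEquivalence _≈ᴱ_
  isEquivalence = record
    { refl  = λ {A} → let x , A∋x = inhabited A in ∋⇒≈ refl A∋x A∋x
    ; sym   = λ A≈B → let eq , x , A∋x , B∋x = Equivalence.to ≈⇔ A≈B in ∋⇒≈ (sym eq) B∋x A∋x
    ; trans = λ A≈B B≈C → let eq , x , A∋x , B∋x = Equivalence.to ≈⇔ A≈B in
                          ∋⇒≈ (trans eq (index-cong B≈C)) A∋x (∋-resp B≈C B∋x)
    }

  -- Inside `B`, sort a path from a point of `A` to a point of `C`. Colours above `index B` do not
  -- leave `A`, colours below it do not leave `C`, so the turning point `z` lies in both.
  <-trans : ∀ {A B C} → A <ᴱ B → B <ᴱ C → A <ᴱ C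
  <-trans {A} {B} {C} A<B B<C =
    let i<j , x , A∋x , B∋x = Equivalence.to <⇔ A<B
        j<k , y , B∋y , C∋y = Equivalence.to <⇔ B<C
        z , p , q = reach-around (∋-connected B B∋x B∋y)
    in ∋⇒< (Fin.<-trans i<j j<k)
           (∋-closed A A∋x (reach-mono (above⊆avoid (ℕ.<⇒≤ i<j)) p))
           (∋-closed C C∋y (reach-mono (below⊆avoid (ℕ.<⇒≤ j<k)) (reach-sym q)))

  isStrictPartialOrder : IsStrictPartialOrder _≈ᴱ_ _<ᴱ_
  isStrictPartialOrder = record
    { isEquivalence = isEquivalence
    ; irrefl        = λ A≈B A<B → Fin.<⇒≢ (index-mono A<B) (index-cong A≈B)
    ; trans         = <-trans
    ; <-resp-≈      =
        (λ {A} B≈C A<B → let lt , x , A∋x , B∋x = Equivalence.to <⇔ A<B in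
          ∋⇒< (subst (index A <_) (index-cong B≈C) lt) A∋x (∋-resp B≈C B∋x)) ,
        (λ {B} A≈C A<B → let lt , x , A∋x , B∋x = Equivalence.to <⇔ A<B in
          ∋⇒< (subst (_< index B) (index-cong A≈C) lt) (∋-resp A≈C A∋x) B∋x)
    }

  -- Built exactly as `cosetPoset`, so that for cosets the two posets agree by definition.
  facePoset : RawRelation e (e ⊔ p) (e ⊔ p)
  facePoset = record
    { Carrier = E ±
    ; _≈_     = AddEquality._≈±_ _≈ᴱ_
    ; _∼_     = AddOrder._≤±_ (NonStrict._≤_ _≈ᴱ_ _<ᴱ_)
    }

-- Ranks, flags and polytopality of a face poset.

module Polytopality {a ℓ e p : Level} (em : ∀ {ℓ} → ExcludedMiddle ℓ) {n : ℕ}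
                    {M : FlagGraph n a ℓ} (M-polytopal : IsPolytopal M)
                    {E : Set e} {_≈ᴱ_ _<ᴱ_ : Rel E (e ⊔ p)}
                    (faces : IsFacePoset {p = p} M _≈ᴱ_ _<ᴱ_) where
  open FlagGraph M
  open IsPolytopal M-polytopal
  open IsFacePoset faces
  open RawRelation facePoset using () renaming (_≈_ to _≈±_; _∼_ to _≤±_)
  open Flags facePoset

  -- With `K` all colours, the path given by `reach-∁` has no colour left to use.
  reach-≈ : ∀ {x y} → (∀ i → Reach (avoid i) x y) → x ≈ y
  reach-≈ around = reach-∅ (λ _ i∉U → i∉U _)
    (reach-∁ intersecting (λ _ → yes _) (connected _ _) (λ {i} (_ : U i) → around i))

  rank : E ± → Fin (2 ℕ.+ n)
  rank ⊥±    = fzero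
  rank [ A ] = properRank (index A)
  rank ⊤±    = fromℕ (ℕ.suc n)

  properRank-injective : ∀ {i j : Fin n} → properRank i ≡ properRank j → i ≡ j
  properRank-injective = Fin.inject₁-injective ∘ Fin.suc-injective

  -- Reduces case analysis on two elements of equal rank from nine cases to three.
  data SameRank : Rel (E ±) e where
    bottom : SameRank ⊥± ⊥±
    proper : ∀ {A B} → index A ≡ index B → SameRank [ A ] [ B ]
    top    : SameRank ⊤± ⊤±

  sameRank : ∀ u v → rank u ≡ rank v → SameRank u v
  sameRank ⊥±    ⊥±    eq = bottom
  sameRank [ A ] [ B ] eq = proper (properRank-injective eq)
  sameRank [ A ] ⊤±    eq = contradiction (sym (Fin.suc-injective eq)) Fin.fromℕ≢inject₁
  sameRank ⊤±    [ A ] eq = contradiction (Fin.suc-injective eq) Fin.fromℕ≢inject₁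
  sameRank ⊤±    ⊤±    eq = top

  OnFlag : Point → Pred (E ±) (e ⊔ p)
  OnFlag x ⊥±    = ⊤
  OnFlag x [ A ] = A ∋ x
  OnFlag x ⊤±    = ⊤

  onFlag-≈ : ∀ {x u v} → OnFlag x u → OnFlag x v → rank u ≡ rank v → u ≈± v
  onFlag-≈ {u = u} {v} x∈u x∈v eq with sameRank u v eq
  ... | bottom    = AddEquality.⊥±≈⊥±
  ... | proper eq = AddEquality.[ ∋⇒≈ eq x∈u x∈v ]
  ... | top       = AddEquality.⊤±≈⊤±

  -- Inverse to `rank` on the flag of a point; used to count the flag.
  nth : Point → Fin (2 ℕ.+ n) → E ±
  nth x fzero    = ⊥±
  nth x (fsuc k) with view k
  ... | ‵fromℕ     = ⊤±
  ... | ‵inject₁ i = [ face i x ]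

  nth∈ : ∀ x k → OnFlag x (nth x k)
  nth∈ x fzero    = tt
  nth∈ x (fsuc k) with view k
  ... | ‵fromℕ     = tt
  ... | ‵inject₁ i = face∋ i x

  rank-nth : ∀ x k → rank (nth x k) ≡ k
  rank-nth x fzero    = refl
  rank-nth x (fsuc k) with view k
  ... | ‵fromℕ     = refl
  ... | ‵inject₁ i = cong properRank (index-face i x)

  rank-cong : ∀ {u v} → u ≈± v → rank u ≡ rank v
  rank-cong AddEquality.⊥±≈⊥±   = refl
  rank-cong AddEquality.[ A≈B ] = cong properRank (index-cong A≈B)
  rank-cong AddEquality.⊤±≈⊤±   = refl

  rank-mono : ∀ {u v} → u ≤± v → ¬ u ≈± v → rank u < rank v
  rank-mono AddOrder.⊥±≤⊥±        u≉v = contradiction AddEquality.⊥±≈⊥± u≉v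
  rank-mono AddOrder.⊥±≤[ A ]     u≉v = ℕ.z<s
  rank-mono AddOrder.[ inj₁ A<B ] u≉v =
    ℕ.s<s (subst₂ ℕ._<_ (sym (Fin.toℕ-inject₁ _)) (sym (Fin.toℕ-inject₁ _)) (index-mono A<B))
  rank-mono AddOrder.[ inj₂ A≈B ] u≉v = contradiction AddEquality.[ A≈B ] u≉v
  rank-mono AddOrder.⊥±≤⊤±        u≉v = ℕ.z<s
  rank-mono AddOrder.[ A ]≤⊤±     u≉v =
    ℕ.s<s (subst (toℕ (inject₁ (index A)) ℕ.<_) (sym (Fin.toℕ-fromℕ n)) (Fin.inject₁ℕ< (index A)))
  rank-mono AddOrder.⊤±≤⊤±        u≉v = contradiction AddEquality.⊤±≈⊤± u≉v

  onFlag-resp : ∀ {x u v} → u ≈± v → OnFlag x u → OnFlag x v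
  onFlag-resp AddEquality.⊥±≈⊥±   _   = tt
  onFlag-resp AddEquality.[ A≈B ] A∋x = ∋-resp A≈B A∋x
  onFlag-resp AddEquality.⊤±≈⊤±   _   = tt

  onFlag-comparable : ∀ {x u v} → OnFlag x u → OnFlag x v → u ≤± v ⊎ v ≤± u
  onFlag-comparable {u = ⊥±}    {v}     _   _   = inj₁ (AddOrder.⊥±≤_ _ v)
  onFlag-comparable {u = ⊤±}    {v}     _   _   = inj₂ (AddOrder._≤⊤± _ v)
  onFlag-comparable {u = [ A ]} {⊥±}    _   _   = inj₂ (AddOrder.⊥±≤_ _ _)
  onFlag-comparable {u = [ A ]} {⊤±}    _   _   = inj₁ (AddOrder._≤⊤± _ _)
  onFlag-comparable {u = [ A ]} {[ B ]} A∋x B∋x with Fin.<-cmp (index A) (index B)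
  ... | tri< lt _ _ = inj₁ AddOrder.[ inj₁ (∋⇒< lt A∋x B∋x) ]
  ... | tri≈ _ eq _ = inj₁ AddOrder.[ inj₂ (∋⇒≈ eq A∋x B∋x) ]
  ... | tri> _ _ gt = inj₂ AddOrder.[ inj₁ (∋⇒< gt B∋x A∋x) ]

  comparable⇒meet : ∀ {A B} → [ A ] ≤± [ B ] ⊎ [ B ] ≤± [ A ] → ∃ λ x → A ∋ x × B ∋ x
  comparable⇒meet (inj₁ AddOrder.[ inj₁ A<B ]) = proj₂ (Equivalence.to <⇔ A<B)
  comparable⇒meet (inj₁ AddOrder.[ inj₂ A≈B ]) = proj₂ (Equivalence.to ≈⇔ A≈B)
  comparable⇒meet (inj₂ AddOrder.[ inj₁ B<A ]) =
    let x , B∋x , A∋x = proj₂ (Equivalence.to <⇔ B<A) in x , A∋x , B∋x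
  comparable⇒meet (inj₂ AddOrder.[ inj₂ B≈A ]) =
    let x , B∋x , A∋x = proj₂ (Equivalence.to ≈⇔ B≈A) in x , A∋x , B∋x

  comparable⇒≈ : ∀ {A B} → [ A ] ≤± [ B ] ⊎ [ B ] ≤± [ A ] → index A ≡ index B → A ≈ᴱ B
  comparable⇒≈ cmp eq = let x , A∋x , B∋x = comparable⇒meet cmp in ∋⇒≈ eq A∋x B∋x

  flagOf : Point → Flag
  flagOf x = record
    { elements = OnFlag x
    ; isChain  = record
      { respects   = onFlag-resp
      ; comparable = λ {u} {v} → onFlag-comparable {x} {u} {v}
      }
    ; maximal  = λ C chain flag⊆C {u} u∈C → maximal C chain flag⊆C u u∈C
    }
    where
    maximal : ∀ C → IsChain C → OnFlag x ⊆ C → ∀ u → u ∈ C → OnFlag x u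
    maximal C chain flag⊆C ⊥±    _   = tt
    maximal C chain flag⊆C ⊤±    _   = tt
    maximal C chain flag⊆C [ A ] A∈C =
      ∋-resp (comparable⇒≈ (IsChain.comparable chain (flag⊆C {[ F ]} F∋x) A∈C) (index-face _ x)) F∋x
      where
      F = face (index A) x
      F∋x = face∋ (index A) x

  flagOf-reach : ∀ {x y} → elements (flagOf x) ⊆ elements (flagOf y) → ∀ i → Reach (avoid i) x y
  flagOf-reach {x} {y} x⊆y i =
    subst (λ j → Reach (avoid j) x y) (index-face i x)
          (∋-connected (face i x) (face∋ i x) (x⊆y {[ face i x ]} (face∋ i x)))

  flagOf-injective : ∀ {x y} → elements (flagOf x) ⊆ elements (flagOf y) → x ≈ y
  flagOf-injective x⊆y = reach-≈ (flagOf-reach (λ {u} → x⊆y {u}))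

  flagOf-mono : ∀ {x y} → x ≈ y → elements (flagOf x) ⊆ elements (flagOf y)
  flagOf-mono x≈y {⊥±}    _   = tt
  flagOf-mono x≈y {[ A ]} A∋x = ∋-closed A A∋x (stop x≈y)
  flagOf-mono x≈y {⊤±}    _   = tt

  module _ {C : Pred (E ±) (e ⊔ p)} (chain : IsChain C) where

    -- Colours above `index B` do not leave any face of index at most `index B`; a face of the chain
    -- with the index of `B` is `B` itself, by comparability.
    above-∋ : ∀ {B x z} → [ B ] ∈ C → B ∋ x →
              (∀ {A} → [ A ] ∈ C → index A < index B → A ∋ x) →
              Reach (above (toℕ (index B))) x z →
              ∀ {A} → [ A ] ∈ C → toℕ (index A) ℕ.< ℕ.suc (toℕ (index B)) → A ∋ z
    above-∋ {B} B∈C B∋x x∈ p {A} A∈C lt with Fin.<-cmp (index A) (index B)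
    ... | tri< A<B _ _ = ∋-closed A (x∈ A∈C A<B) (reach-mono (above⊆avoid (ℕ.<⇒≤ A<B)) p)
    ... | tri≈ _ eq _  =
      ∋-resp (comparable⇒≈ (IsChain.comparable chain B∈C A∈C) (sym eq))
             (∋-closed B B∋x (reach-mono (above⊆avoid ℕ.≤-refl) p))
    ... | tri> _ _ B<A = contradiction (ℕ.m<1+n⇒m≤n lt) (ℕ.<⇒≱ B<A)

    -- S is the set of points among which a common point is sought; in the
    -- induction it is a face of the chain above the faces of index below k.
    chain-meet : ∀ k (S : Pred Point (e ⊔ p)) → (∀ {x y} → x ∈ S → Reach (below k) x y → y ∈ S) →
                 (∀ {A} → [ A ] ∈ C → toℕ (index A) ℕ.< k → ∃ λ x → A ∋ x × x ∈ S) → ∃ S →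
                 ∃ λ x → x ∈ S × (∀ {A} → [ A ] ∈ C → toℕ (index A) ℕ.< k → A ∋ x)
    chain-meet ℕ.zero    S closed meets (x , x∈S) = x , x∈S , λ _ ()
    chain-meet (ℕ.suc k) S closed meets inhab
      with em {P = ∃ λ A → [ A ] ∈ C × toℕ (index A) ≡ k}
    ... | no none =
      let x , x∈S , x∈A = chain-meet k S
            (λ x∈S p → closed x∈S (reach-mono ℕ.m<n⇒m<1+n p))
            (λ A∈C lt → meets A∈C (ℕ.m<n⇒m<1+n lt)) inhab
      in x , x∈S , λ A∈C lt →
           x∈A A∈C (ℕ.≤∧≢⇒< (ℕ.m<1+n⇒m≤n lt) (λ eq → none (_ , A∈C , eq)))
    ... | yes (B , B∈C , refl) =
      -- For the faces of smaller index, `B` takes the place of `S`.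
      let x , B∋x , x∈A = chain-meet (toℕ (index B)) (B ∋_)
            (λ B∋x p → ∋-closed B B∋x (reach-mono (below⊆avoid ℕ.≤-refl) p))
            (λ A∈C _ → comparable⇒meet (IsChain.comparable chain A∈C B∈C)) (inhabited B)
          y , B∋y , y∈S = meets B∈C ℕ.≤-refl
          -- From `x` to `z` the faces up to `B` are kept, and from `y` back to `z` membership in
          -- `S` is kept.
          z , p , q = reach-around (∋-connected B B∋x B∋y)
      in z , closed y∈S (reach-mono ℕ.m<n⇒m<1+n (reach-sym q)) , above-∋ B∈C B∋x x∈A p

    chain-point : ∃ λ x → C ⊆ OnFlag x
    chain-point =
      let x , _ , x∈ = chain-meet n (λ _ → ⊤) _ (λ {A} _ _ → _ , proj₂ (inhabited A) , tt) (origin , tt)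
          C⊆ : ∀ u → u ∈ C → OnFlag x u
          C⊆ = λ { ⊥± _ → tt ; [ A ] A∈C → x∈ A∈C (Fin.toℕ<n (index A)) ; ⊤± _ → tt }
      in x , λ {u} → C⊆ u

  point : Flag → Point
  point Φ = proj₁ (chain-point (Flag.isChain Φ))

  -- The inclusion from `chain-point` is an equality because `Φ` is a maximal chain.
  ≈flagOf-point : ∀ Φ → Φ ≈ᶠ flagOf (point Φ)
  ≈flagOf-point Φ = Φ⊆ , Flag.maximal Φ _ (Flag.isChain (flagOf (point Φ))) Φ⊆
    where
    Φ⊆ : elements Φ ⊆ OnFlag (point Φ)
    Φ⊆ = proj₂ (chain-point (Flag.isChain Φ))

  point-injective : ∀ {Φ Ψ} → point Φ ≈ point Ψ → Φ ≈ᶠ Ψ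
  point-injective {Φ} {Ψ} eq =
    (λ {u} u∈Φ → proj₂ (≈flagOf-point Ψ) (flagOf-mono eq {u} (proj₁ (≈flagOf-point Φ) u∈Φ))) ,
    (λ {u} u∈Ψ → proj₂ (≈flagOf-point Φ) (flagOf-mono (≈-sym eq) {u} (proj₁ (≈flagOf-point Ψ) u∈Ψ)))

  point-flagOf : ∀ x → point (flagOf x) ≈ x
  point-flagOf x = flagOf-injective (λ {u} → proj₂ (≈flagOf-point (flagOf x)) {u})

  -- If `x` and `r i x` also shared their component for colour `i`, they would share all components
  -- and coincide, against `r-free`.
  r-avoid⇔ : ∀ i x j → Reach (avoid j) x (r i x) ⇔ j ≢ i
  r-avoid⇔ i x j = mk⇔ (λ { p refl → r-free i x (≈-sym (reach-≈ (around p))) }) aside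
    where
    aside : ∀ {j} → j ≢ i → Reach (avoid j) x (r i x)
    aside j≢i = step (j≢i ∘ sym) reach-refl

    around : Reach (avoid i) x (r i x) → ∀ j → Reach (avoid j) x (r i x)
    around p j with j Fin.≟ i
    ... | yes refl = p
    ... | no j≢i   = aside j≢i

  adjacent⇐ : ∀ {i Φ Ψ} → r i (point Φ) ≈ point Ψ → Adjacent rank i Φ Ψ
  adjacent⇐ {i} {Φ} {Ψ} eq {u} {v} u∈Φ v∈Ψ same
    with sameRank u v same | proj₁ (≈flagOf-point Φ) u∈Φ | proj₁ (≈flagOf-point Ψ) v∈Ψ
  ... | bottom | _ | _ = mk⇔ (λ _ ()) (λ _ → AddEquality.⊥±≈⊥±)
  ... | top    | _ | _ = mk⇔
    (λ _ top≡ → Fin.fromℕ≢inject₁ (Fin.suc-injective top≡)) (λ _ → AddEquality.⊤±≈⊤±)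
  ... | proper {A} {B} ≡ᴵ | A∋x | B∋y = mk⇔
    (λ A≈B A≡i → Equivalence.to (r-avoid⇔ i (point Φ) (index A))
      (reach-respʳ (∋-connected A A∋x
        (∋-resp (IsEquivalence.sym isEquivalence (AddEquality.[≈]-injective _ A≈B)) B∋y)) (≈-sym eq))
      (properRank-injective A≡i))
    (λ A≢i → AddEquality.[ ∋⇒≈ ≡ᴵ (∋-closed A A∋x (reach-respʳ
      (Equivalence.from (r-avoid⇔ i (point Φ) (index A)) (A≢i ∘ cong properRank)) eq)) B∋y ])

  -- Only colour `i` is available, so the path goes back and forth and only its parity matters.
  reach-single : ∀ {i x y} → Reach (∁ (avoid i)) x y → x ≈ y ⊎ r i x ≈ y
  reach-single (stop x≈y) = inj₁ x≈y
  reach-single {i} (step {k = k} ¬¬ p) with k Fin.≟ i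
  ... | no k≢i = contradiction k≢i ¬¬
  ... | yes refl with reach-single p
  ...   | inj₁ eq = inj₂ eq
  ...   | inj₂ eq = inj₁ (≈-trans (≈-sym (r-involutive i _)) eq)

  face-≈⇔ : ∀ j x y → face j x ≈ᴱ face j y ⇔ Reach (avoid j) x y
  face-≈⇔ j x y = mk⇔
    (λ eq → subst (λ k → Reach (avoid k) x y) (index-face j x)
      (∋-connected (face j x) (face∋ j x)
        (∋-resp (IsEquivalence.sym isEquivalence eq) (face∋ j y))))
    (λ p → ∋⇒≈ (trans (index-face j x) (sym (index-face j y)))
      (∋-closed (face j x) (face∋ j x)
        (subst (λ k → Reach (avoid k) x y) (sym (index-face j x)) p))
      (face∋ j y))

  adjacent-avoid⇔ : ∀ {i Φ Ψ} → Adjacent rank i Φ Ψ →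
                    ∀ j → Reach (avoid j) (point Φ) (point Ψ) ⇔ j ≢ i
  adjacent-avoid⇔ {i} {Φ} {Ψ} adj j = mk⇔
    (λ p j≡i → Equivalence.to at-j AddEquality.[ Equivalence.from ≈⇔reach p ]
                 (cong properRank (trans (index-face j x) j≡i)))
    (λ j≢i → Equivalence.to ≈⇔reach (AddEquality.[≈]-injective _ (Equivalence.from at-j
               (λ eq → j≢i (trans (sym (index-face j x)) (properRank-injective eq))))))
    where
    x = point Φ
    y = point Ψ
    ≈⇔reach = face-≈⇔ j x y
    at-j = adj (proj₂ (≈flagOf-point Φ) {[ face j x ]} (face∋ j x))
               (proj₂ (≈flagOf-point Ψ) {[ face j y ]} (face∋ j y))
               (cong properRank (trans (index-face j x) (sym (index-face j y))))

  -- With `K` all colours but `i`, the two points are joined using colour `i` alone; they are not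
  -- equal, since the flags differ at rank `i`.
  adjacent⇒ : ∀ {i Φ Ψ} → Adjacent rank i Φ Ψ → r i (point Φ) ≈ point Ψ
  adjacent⇒ {i} {Φ} {Ψ} adj
    with reach-single (reach-∁ intersecting (λ _ → em) (connected _ _)
           (λ {j} → Equivalence.from (adjacent-avoid⇔ {i} {Φ} {Ψ} adj j)))
  ... | inj₁ eq = contradiction refl (Equivalence.to (adjacent-avoid⇔ {i} {Φ} {Ψ} adj i) (stop eq))
  ... | inj₂ eq = eq

  diamond : ∀ Φ i → ∃! _≈ᶠ_ (Adjacent rank i Φ)
  diamond Φ i = Φⁱ , (λ {u} {v} → adjacent⇐ {i} {Φ} {Φⁱ} (≈-sym (point-flagOf _)) {u} {v}) ,
    λ {Ψ} adj → point-injective {Φⁱ} {Ψ}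
      (≈-trans (point-flagOf _) (adjacent⇒ {i} {Φ} {Ψ} adj))
    where
    Φⁱ = flagOf (r i (point Φ))

  reach⇒joined : ∀ {I : Pred (Fin n) i} {S : Pred (E ±) (e ⊔ p)} →
                 (∀ {A k} → [ A ] ∈ S → k ∈ I → k ≢ index A) →
                 ∀ {Φ Ψ} → Reach I (point Φ) (point Ψ) → S ⊆ elements Φ → Joined rank S Φ Ψ
  reach⇒joined {I = I} {S} fixed {Φ} {Ψ} p S⊆Φ = go Φ p ≈-refl S⊆Φ
    where
    -- The start `x` is kept apart from `point Φ`, because `point (flagOf x)` is `x` only up to `≈`.
    go : ∀ Φ {x} → Reach I x (point Ψ) → point Φ ≈ x → S ⊆ elements Φ → Joined rank S Φ Ψ
    go Φ (stop x≈Ψ) Φ≈x S⊆Φ = stop S⊆Φ (point-injective {Φ} {Ψ} (≈-trans Φ≈x x≈Ψ))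
    go Φ (step {x} {k = k} k∈I p) Φ≈x S⊆Φ =
      step k S⊆Φ
        (λ {u} {v} → adjacent⇐ {k} {Φ} {Φᵏ}
          (≈-trans (r-cong k Φ≈x) (≈-sym (point-flagOf _))) {u} {v})
        (go Φᵏ p (point-flagOf _) (λ {u} → S⊆Φᵏ u))
      where
      Φᵏ = flagOf (r k x)

      S⊆Φᵏ : ∀ u → u ∈ S → OnFlag (r k x) u
      S⊆Φᵏ ⊥±    _   = tt
      S⊆Φᵏ ⊤±    _   = tt
      S⊆Φᵏ [ A ] A∈S = ∋-closed A (flagOf-mono Φ≈x {[ A ]} (proj₁ (≈flagOf-point Φ) (S⊆Φ A∈S)))
                         (step (fixed A∈S k∈I) reach-refl)

  isPolytope : IsPolytope n facePoset
  isPolytope = record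
    { isPartialOrder = AddOrder.≤±-isPartialOrder _ (NonStrict.isPartialOrder _ _ isStrictPartialOrder)
    ; isFlagged      = record
      { least       = ⊥± , AddOrder.≤±-minimum _
      ; greatest    = ⊤± , AddOrder.≤±-maximum _
      ; cardinality = λ Φ →
          let enum , enum-bijective = onFlag-cardinality (point Φ)
              Φ⊆ , ⊆Φ = ≈flagOf-point Φ
          in (λ k → proj₁ (enum k) , ⊆Φ (proj₂ (enum k))) ,
             proj₁ enum-bijective ,
             λ (u , u∈Φ) → proj₂ enum-bijective (u , Φ⊆ u∈Φ)
      }
    ; rank           = rank
    ; isRankFunction = record
      { rank-cong = rank-cong
      ; rank-mono = rank-mono
      ; rank-onto = λ k → nth origin k , λ eq → trans (rank-cong eq) (rank-nth origin k)
      }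
    ; diamond               = diamond
    ; stronglyFlagConnected = λ Φ Ψ →
        reach⇒joined {S = elements Φ ∩ elements Ψ}
          (λ { {A} (A∈Φ , A∈Ψ) k∉K refl → k∉K (∋-connected A
                 (proj₁ (≈flagOf-point Φ) A∈Φ) (proj₁ (≈flagOf-point Ψ) A∈Ψ)) })
          {Φ} {Ψ}
          -- `K` consists of the ranks at which the two flags share a face.
          (reach-∁ intersecting {K = λ k → Reach (avoid k) (point Φ) (point Ψ)} (λ _ → em)
            (connected _ _) id)
          proj₁
    }
    where
    onFlag-cardinality : ∀ x → HasCardinality (2 ℕ.+ n) (OnFlag x)
    onFlag-cardinality x = (λ k → nth x k , nth∈ x k) ,
      (λ {k} {l} eq → trans (sym (rank-nth x k)) (trans (rank-cong eq) (rank-nth x l))) ,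
      (λ (u , x∈u) → rank u , λ { refl →
        onFlag-≈ {x} {nth x (rank u)} {u} (nth∈ x (rank u)) x∈u (rank-nth x (rank u)) })

-- The derived graph as a flag graph

module Derived {v ℓv d ℓd c ℓ : Level} {n : ℕ} {X : ColouredGraph n v ℓv d ℓd}
               (premaniplex : IsPremaniplex X) {Γ : Group c ℓ} (V : VoltageAssignment X Γ)
               (maniplex : IsManiplex (derivedGraph V)) where
  open ColouredGraph X
  open IsPremaniplex premaniplex using (linksOrSemiEdges; edgeOfColour; uniqueOfColour)
  open VoltageAssignment V hiding (Voltages)
  module Vertex = Setoid vertexSetoid
  module Dart = Setoid dartSetoid
  module Γ = Group Γ
  module ΓProps = GroupProperties Γ
  module D = ColouredGraph (derivedGraph V)
  module Maniplex = IsManiplex maniplex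
  open Γ using (_∙_; _⁻¹; ε)

  -- If `d` were the inverse of `e`, then `e` would start and end at the same vertex, hence be a
  -- semi-edge and its own inverse.
  dart-≈ : ∀ {d e} → init d ≈ᵥ init e → colour d ≡ colour e → d ≈ᵈ e
  dart-≈ {d} {e} init≈ colour≡ with uniqueOfColour init≈ colour≡
  ... | inj₁ d≈e = d≈e
  ... | inj₂ d≈e⁻¹ with linksOrSemiEdges e
  ...   | inj₁ link = contradiction
    (Vertex.trans (Vertex.sym init≈) (Vertex.trans (init-cong d≈e⁻¹) (init-inv e))) link
  ...   | inj₂ semi = Dart.trans d≈e⁻¹ semi

  dartAt : Vertex → Fin n → Dart
  dartAt x i = proj₁ (edgeOfColour x i)

  init-dartAt : ∀ x i → init (dartAt x i) ≈ᵥ x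
  init-dartAt x i = proj₁ (proj₂ (edgeOfColour x i))

  colour-dartAt : ∀ x i → colour (dartAt x i) ≡ i
  colour-dartAt x i = proj₂ (proj₂ (edgeOfColour x i))

  ≈dartAt : ∀ {e x i} → init e ≈ᵥ x → colour e ≡ i → e ≈ᵈ dartAt x i
  ≈dartAt init≈ colour≡ = dart-≈ (Vertex.trans init≈ (Vertex.sym (init-dartAt _ _)))
                                 (trans colour≡ (sym (colour-dartAt _ _)))

  r : Fin n → D.Vertex → D.Vertex
  r i (x , γ) = term (dartAt x i) , ξ (dartAt x i) ∙ γ

  module DVertex = Setoid D.vertexSetoid

  r-dart : ∀ {x y i} (e : D.Dart) → D.init e D.≈ᵥ x → D.colour e ≡ i → D.term e D.≈ᵥ y →
           r i x D.≈ᵥ y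
  r-dart e (x≈ , γ≈) colour≡ term≈ = DVertex.trans
    (DVertex.sym (D.term-cong (≈dartAt x≈ colour≡ , γ≈))) term≈

  r-cong : ∀ i {x y} → x D.≈ᵥ y → r i x D.≈ᵥ r i y
  r-cong i {x , γ} x≈y = DVertex.sym (r-dart (dartAt x i , γ)
    (DVertex.trans (init-dartAt x i , Γ.refl) x≈y) (colour-dartAt x i) DVertex.refl)

  r-involutive : ∀ i x → r i (r i x) D.≈ᵥ x
  r-involutive i (x , γ) = r-dart (D.inv f) (D.init-inv f) (trans (D.colour-inv f) (colour-dartAt x i))
    (DVertex.trans (DVertex.sym (D.init-inv (D.inv f)))
      (DVertex.trans (D.init-cong (D.inv-involutive f)) (init-dartAt x i , Γ.refl)))
    where f = dartAt x i , γ

  r-free : ∀ i x → ¬ r i x D.≈ᵥ x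
  r-free i (x , γ) fixed = Maniplex.links (dartAt x i , γ)
    (DVertex.trans (init-dartAt x i , Γ.refl) (DVertex.sym fixed))

  -- Colours alternate along the 4-cycle through `x`, as two consecutive sides of one colour would
  -- identify two opposite corners. Both sides of the equation are then the corner opposite `x`,
  -- reached the two ways round.
  r-commute : ∀ {i j} → ∣ toℕ i - toℕ j ∣ ℕ.> 1 → ∀ x → r i (r j x) D.≈ᵥ r j (r i x)
  r-commute {i} {j} far x with Maniplex.fourCycles far x
  ... | cycle = conclude (coloured 0F)
    where
    open IsFourCycle cycle

    corner : Fin 4 → D.Vertex
    corner k = D.init (dart k)

    side : ∀ {k i} → D.colour (dart k) ≡ i → r i (corner k) D.≈ᵥ corner (next X k)
    side {k} colour≡ = r-dart (dart k) DVertex.refl colour≡ (cyclic k)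

    side⁻¹ : ∀ {k i} → D.colour (dart k) ≡ i → r i (corner (next X k)) D.≈ᵥ corner k
    side⁻¹ colour≡ = DVertex.trans (r-cong _ (DVertex.sym (side colour≡))) (r-involutive _ _)

    next²≢ : ∀ k → next X (next X k) ≢ k
    next²≢ 0F ()
    next²≢ 1F ()
    next²≢ 2F ()
    next²≢ 3F ()

    alternates : ∀ k {a b} → D.colour (dart k) ≡ a → D.colour (dart (next X k)) ≡ b → a ≢ b
    alternates k a≡ b≡ refl = next²≢ k
      (distinct (DVertex.trans (DVertex.sym (side b≡)) (side⁻¹ a≡)))

    i⇒j : ∀ k → D.colour (dart k) ≡ i → D.colour (dart (next X k)) ≡ j
    i⇒j k ≡i with coloured (next X k)
    ... | inj₁ ≡i′ = contradiction refl (alternates k ≡i ≡i′)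
    ... | inj₂ ≡j  = ≡j

    j⇒i : ∀ k → D.colour (dart k) ≡ j → D.colour (dart (next X k)) ≡ i
    j⇒i k ≡j with coloured (next X k)
    ... | inj₁ ≡i  = ≡i
    ... | inj₂ ≡j′ = contradiction refl (alternates k ≡j ≡j′)

    opposite : ∀ {a b} → D.colour (dart 0F) ≡ a → D.colour (dart 1F) ≡ b →
               D.colour (dart 2F) ≡ a → D.colour (dart 3F) ≡ b →
               r b (r a x) D.≈ᵥ r a (r b x)
    opposite c₀ c₁ c₂ c₃ = DVertex.trans
      (r-cong _ (DVertex.trans (r-cong _ (DVertex.sym start)) (side c₀)))
      (DVertex.trans (side c₁) (DVertex.sym
        (DVertex.trans (r-cong _ (DVertex.trans (r-cong _ (DVertex.sym start)) (side⁻¹ c₃)))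
                       (side⁻¹ c₂))))

    conclude : D.colour (dart 0F) ≡ i ⊎ D.colour (dart 0F) ≡ j → r i (r j x) D.≈ᵥ r j (r i x)
    conclude (inj₁ c₀) = let c₁ = i⇒j 0F c₀; c₂ = j⇒i 1F c₁; c₃ = i⇒j 2F c₂ in
      DVertex.sym (opposite c₀ c₁ c₂ c₃)
    conclude (inj₂ c₀) = let c₁ = j⇒i 0F c₀; c₂ = i⇒j 1F c₁; c₃ = j⇒i 2F c₂ in
      opposite c₀ c₁ c₂ c₃

  flagGraph : FlagGraph n (v ⊔ c) (ℓv ⊔ ℓ)
  flagGraph = record
    { setoid       = D.vertexSetoid
    ; r            = r
    ; r-cong       = r-cong
    ; r-involutive = r-involutive
    ; r-commute    = r-commute
    }

  open FlagGraph flagGraph hiding (r; r-cong; r-involutive; r-commute)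

  path⇒reach : ∀ {I : Pred (Fin n) i} {x y} (p : Path x y) → All I (colours p) →
               ∀ γ → Reach I (x , γ) (y , voltage p ∙ γ)
  path⇒reach (stop x≈y)     []           γ = stop (x≈y , Γ.sym (Γ.identityˡ γ))
  path⇒reach (step e x≈e p) (i∈I ∷ rest) γ = step i∈I
    (reach-respˡ (r-dart (e , γ) (Vertex.sym x≈e , Γ.refl) refl DVertex.refl)
      (reach-respʳ (path⇒reach p rest (ξ e ∙ γ)) (Vertex.refl , Γ.sym (Γ.assoc _ _ _))))

  reach⇒path : ∀ {I : Pred (Fin n) i} {x y γ δ} → Reach I (x , γ) (y , δ) →
               ∃ λ (p : Path x y) → All I (colours p) × voltage p ∙ γ Γ.≈ δ
  reach⇒path (stop (x≈y , γ≈δ)) = stop x≈y , [] , Γ.trans (Γ.identityˡ _) γ≈δ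
  reach⇒path {I = I} {x} (step {k = k} k∈I q) =
    let p , rest , eq = reach⇒path q in
    step (dartAt x k) (Vertex.sym (init-dartAt x k)) p ,
    subst I (sym (colour-dartAt x k)) k∈I ∷ rest ,
    Γ.trans (Γ.assoc _ _ _) eq

  voltages⇒reach : ∀ {I : Pred (Fin n) i} {x y g} → Voltages V I x y g →
                   ∀ γ → Reach I (x , γ) (y , g ∙ γ)
  voltages⇒reach (p , p∈I , eq) γ =
    reach-respʳ (path⇒reach p p∈I γ) (Vertex.refl , Γ.∙-congʳ eq)

  component⇒reach : ∀ {I : Pred (Fin n) i} {x y} → y ∈ Component X I x →
                    ∃ λ γ → Reach I (x , ε) (y , γ)
  component⇒reach (p , p∈I) = _ , path⇒reach p p∈I ε

  reach⇒component : ∀ {I : Pred (Fin n) i} {x y γ δ} → Reach I (x , γ) (y , δ) → y ∈ Component X I x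
  reach⇒component q = let p , p∈I , _ = reach⇒path q in p , p∈I

  act : D.Vertex → Γ.Carrier → D.Vertex
  act (x , γ) g = x , γ ∙ g

  -- Voltages multiply on the left, so right multiplication commutes with every step.
  reach-act : ∀ {I : Pred (Fin n) i} g {x y} → Reach I x y → Reach I (act x g) (act y g)
  reach-act g (stop (x≈y , γ≈δ)) = stop (x≈y , Γ.∙-congʳ γ≈δ)
  reach-act g (step k∈I p) = step k∈I (reach-respˡ (Vertex.refl , Γ.sym (Γ.assoc _ _ _)) (reach-act g p))

  component-sym : ∀ {I : Pred (Fin n) i} {x y} → y ∈ Component X I x → x ∈ Component X I y
  component-sym = reach⇒component ∘ reach-sym ∘ proj₂ ∘ component⇒reach

  component-trans : ∀ {I : Pred (Fin n) i} {x y z} →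
                    y ∈ Component X I x → z ∈ Component X I y → z ∈ Component X I x
  component-trans y∈ z∈ =
    let γ , p = component⇒reach y∈
        _ , q = component⇒reach z∈
    -- The second lift starts over `ε` and is translated by `γ` to start where the first one ends.
    in reach⇒component (reach-trans (reach-respʳ p (Vertex.refl , Γ.sym (Γ.identityˡ γ))) (reach-act γ q))

  component-≐ : ∀ {I : Pred (Fin n) i} {x y} → y ∈ Component X I x → Component X I x ≐ Component X I y
  component-≐ y∈ = component-trans (component-sym y∈) , component-trans y∈

  path⇒reach-U : ∀ {x y} → D.Path x y → Reach U x y
  path⇒reach-U (D.stop x≈y) = stop x≈y
  path⇒reach-U (D.step e x≈e p) =
    step {k = D.colour e} _ (reach-respˡ (r-dart e (DVertex.sym x≈e) refl DVertex.refl) (path⇒reach-U p))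

  IntervalIntersection : Set _
  IntervalIntersection = ∀ (k m : Fin n) x y →
    Voltages V (interval 0 (toℕ m)) x y ∩ Voltages V (interval (toℕ k) (n ∸ 1)) x y
      ≐ Voltages V (interval (toℕ k) (toℕ m)) x y

  -- The hypothesis speaks of closed intervals between actual colours; when a bound falls outside
  -- them, one of the two given paths already has the required colours.
  isIntersecting : IntervalIntersection → IsIntersecting
  isIntersecting intersection k ℕ.zero p q = reach-mono (λ ()) p
  isIntersecting intersection k (ℕ.suc m) {x , γ} {y , δ} p q with m ℕ.<? n | k ℕ.<? n
  ... | no m≮n | _ = reach-mono
    (λ k≤i → k≤i , ℕ.m<n⇒m<1+n (ℕ.<-≤-trans (Fin.toℕ<n _) (ℕ.≮⇒≥ m≮n))) q
  ... | yes _ | no k≮n = reach-mono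
    (λ k≤i → contradiction (ℕ.≤-<-trans k≤i (Fin.toℕ<n _)) k≮n) q
  ... | yes m<n | yes k<n =
    let p₁ , p₁∈ , eq₁ = reach⇒path p
        p₂ , p₂∈ , eq₂ = reach⇒path q
        g∈ = proj₁ (intersection (fromℕ< k<n) (fromℕ< m<n) x y)
          ( (p₁ , All.map (λ i<m → ℕ.z≤n , subst (_ ℕ.≤_) (sym m≡) (ℕ.m<1+n⇒m≤n i<m)) p₁∈ , Γ.refl)
          , (p₂ , All.map (λ k≤i → subst (ℕ._≤ _) (sym k≡) k≤i , ℕ.<⇒≤pred (Fin.toℕ<n _)) p₂∈ ,
             -- The two paths have equal voltage because both lifts lead from `γ` to `δ`.
             ΓProps.∙-cancelʳ γ _ _ (Γ.trans eq₂ (Γ.sym eq₁))))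
    in reach-respʳ
         (reach-mono (λ (k≤i , i≤m) → subst (ℕ._≤ _) k≡ k≤i , ℕ.s≤s (subst (_ ℕ.≤_) m≡ i≤m))
           (voltages⇒reach g∈ γ))
         (Vertex.refl , eq₁)
    where
    k≡ = Fin.toℕ-fromℕ< k<n
    m≡ = Fin.toℕ-fromℕ< m<n

  isPolytopal : IntervalIntersection → IsPolytopal flagGraph
  isPolytopal intersection = record
    { origin       = proj₁ Maniplex.connected
    ; connected    = λ x y → path⇒reach-U (proj₂ Maniplex.connected x y)
    ; r-free       = r-free
    ; intersecting = isIntersecting intersection
    }

-- Cosets as faces

module CosetFaces {v ℓv d ℓd c ℓ : Level} {n : ℕ} {X : ColouredGraph n v ℓv d ℓd}
                  (premaniplex : IsPremaniplex X) {Γ : Group c ℓ} (V : VoltageAssignment X Γ)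
                  (maniplex : IsManiplex (derivedGraph V))
                  (f : BaseVertices X) (Ws : BasePaths f) where
  open ColouredGraph X
  open BaseVertices f
  open BasePaths Ws
  open Derived premaniplex V maniplex public
  open FlagGraph flagGraph hiding (r; r-cong; r-involutive; r-commute)
  open CosetPoset V f Ws
  open Element
  open Γ using (_∙_; _⁻¹; ε)

  root : Element → Point
  root A = base (index A) (vertex A) , representative A

  -- Phrased like the condition in `_<ᴱ_`, so that `<ᴱ⇔` is a mere repackaging; `∋⇔reach` recovers
  -- the component.
  _∋_ : Element → Point → Set (v ⊔ ℓv ⊔ d ⊔ c ⊔ ℓ)
  A ∋ (y , δ) = y ∈ component A × (α (index A) y ∙⟩ coset A) δ

  W-reach : ∀ i y δ → Reach (avoid i) (base i y , δ) (y , α i y ∙ δ)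
  W-reach i y δ = path⇒reach (W i y) (W-avoid i y) δ

  W-reach⁻¹ : ∀ i y δ → Reach (avoid i) (base i y , α i y ⁻¹ ∙ δ) (y , δ)
  W-reach⁻¹ i y δ = reach-respʳ (W-reach i y _) (Vertex.refl , ΓProps.\\-leftDividesˡ _ _)

  coset⇒reach : ∀ A {δ} → δ ∈ coset A → Reach (avoid (index A)) (root A) (base (index A) (vertex A) , δ)
  coset⇒reach A (η , η∈ , δ≈) =
    reach-respʳ (voltages⇒reach η∈ (representative A)) (Vertex.refl , Γ.sym δ≈)

  reach⇒coset : ∀ A {y δ} → y ≈ᵥ base (index A) (vertex A) →
                Reach (avoid (index A)) (root A) (y , δ) → δ ∈ coset A
  reach⇒coset A y≈ q =
    let p , p∈ , eq = reach⇒path (reach-respʳ q (y≈ , Γ.refl)) in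
    _ , (p , p∈ , Γ.refl) , Γ.sym eq

  -- Lifting `W i y` multiplies by `α i y`, so this multiple of the coset is the fibre over `y` of
  -- the component of `root A`.
  ∋⇔reach : ∀ A {x} → A ∋ x ⇔ Reach (avoid (index A)) (root A) x
  ∋⇔reach A@(element i z γ) {y , δ} = mk⇔
    (λ (y∈ , κ , κ∈ , δ≈) → reach-trans
      (reach-respʳ (coset⇒reach A κ∈) (base-cong i (component-≐ y∈) , Γ.refl))
      (reach-respʳ (W-reach i y κ) (Vertex.refl , Γ.sym δ≈)))
    (λ p →
      let y∈ = component-trans (base∈ i z) (reach⇒component p) in
      y∈ , _ ,
      reach⇒coset A (Vertex.sym (base-cong i (component-≐ y∈)))
        (reach-trans p (reach-sym (W-reach⁻¹ i y δ))) ,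
      Γ.sym (ΓProps.\\-leftDividesˡ _ _))

  ∋-root : ∀ A → A ∋ root A
  ∋-root A = Equivalence.from (∋⇔reach A) reach-refl

  ∋-closed : ∀ A {x y} → A ∋ x → Reach (avoid (index A)) x y → A ∋ y
  ∋-closed A A∋x p =
    Equivalence.from (∋⇔reach A) (reach-trans (Equivalence.to (∋⇔reach A) A∋x) p)

  coset-⊆ : ∀ {A B} → index A ≡ index B → component A ≐ component B →
            Reach (avoid (index B)) (root B) (root A) → coset A ⊆ coset B
  coset-⊆ {A} {B} refl comp≐ p δ∈ =
    reach⇒coset B (base-cong (index B) comp≐) (reach-trans p (coset⇒reach A δ∈))

  ≈ᴱ⇔ : ∀ {A B} → A ≈ᴱ B ⇔ (index A ≡ index B × ∃ λ x → A ∋ x × B ∋ x)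
  ≈ᴱ⇔ {A} {B} = mk⇔ to from
    where
    to : A ≈ᴱ B → index A ≡ index B × ∃ λ x → A ∋ x × B ∋ x
    to record { sameIndex = refl ; sameComponent = comp≐ ; sameCoset = coset≐ } =
      refl , root A , ∋-root A , Equivalence.from (∋⇔reach B)
        -- The representative of `A` lies in the coset of `A`, hence in that of `B`.
        (reach-respʳ (coset⇒reach B (proj₁ coset≐ (reach⇒coset A Vertex.refl reach-refl)))
                     (Vertex.sym (base-cong (index A) comp≐) , Γ.refl))

    from : (index A ≡ index B × ∃ λ x → A ∋ x × B ∋ x) → A ≈ᴱ B
    from (refl , x , A∋x@(x∈A , _) , B∋x@(x∈B , _)) = record
      { sameIndex     = refl
      ; sameComponent = comp≐
      ; sameCoset     = coset-⊆ {A} {B} refl comp≐ (reach-sym A~B) ,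
                        coset-⊆ {B} {A} refl (≐-sym comp≐) A~B
      }
      where
      comp≐ = ≐-trans (component-≐ x∈A) (≐-sym (component-≐ x∈B))
      A~B = reach-trans (Equivalence.to (∋⇔reach A) A∋x) (reach-sym (Equivalence.to (∋⇔reach B) B∋x))

  <ᴱ⇔ : ∀ {A B} → A <ᴱ B ⇔ (index A < index B × ∃ λ x → A ∋ x × B ∋ x)
  <ᴱ⇔ = mk⇔
    (λ A<B → let open _<ᴱ_ A<B; δ , δ∈A , δ∈B = intersect in
      index< , (common , δ) , (proj₁ common∈ , δ∈A) , (proj₂ common∈ , δ∈B))
    (λ (lt , (y , δ) , (y∈A , δ∈A) , (y∈B , δ∈B)) → record
      { index< = lt ; common = y ; common∈ = y∈A , y∈B ; intersect = δ , δ∈A , δ∈B })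

  isFacePoset : IsFacePoset {p = v ⊔ ℓv ⊔ d ⊔ c ⊔ ℓ} flagGraph _≈ᴱ_ _<ᴱ_
  isFacePoset = record
    { index       = index
    ; _∋_         = _∋_
    ; inhabited   = λ A → root A , ∋-root A
    ; ∋-connected = λ A A∋x A∋y → reach-trans (reach-sym (Equivalence.to (∋⇔reach A) A∋x))
                                              (Equivalence.to (∋⇔reach A) A∋y)
    ; ∋-closed    = ∋-closed
    -- The representative is where the lift of `W i y` ending at `(y , δ)` starts.
    ; face        = λ i (y , δ) → element i y (α i y ⁻¹ ∙ δ)
    ; index-face  = λ _ _ → refl
    ; face∋       = λ i (y , δ) → Equivalence.from (∋⇔reach (element i y _)) (W-reach⁻¹ i y δ)
    ; ≈⇔          = ≈ᴱ⇔
    ; <⇔          = <ᴱ⇔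
    }

  module Faces = IsFacePoset isFacePoset

  translate : Element → Γ.Carrier → Element
  translate (element i y γ) g = element i y (γ ∙ g)

  ∋-act : ∀ A g {x} → A ∋ x → translate A g ∋ act x g
  ∋-act A g A∋x = Equivalence.from (∋⇔reach (translate A g))
    (reach-act g (Equivalence.to (∋⇔reach A) A∋x))

  translate-cong : ∀ {A B} g → A ≈ᴱ B → translate A g ≈ᴱ translate B g
  translate-cong {A} {B} g A≈B =
    let eq , x , A∋x , B∋x = Equivalence.to ≈ᴱ⇔ A≈B in
    Equivalence.from ≈ᴱ⇔ (eq , act x g , ∋-act A g A∋x , ∋-act B g B∋x)

  translate-mono : ∀ {A B} g → A <ᴱ B → translate A g <ᴱ translate B g
  translate-mono {A} {B} g A<B =
    let lt , x , A∋x , B∋x = Equivalence.to <ᴱ⇔ A<B in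
    Equivalence.from <ᴱ⇔ (lt , act x g , ∋-act A g A∋x , ∋-act B g B∋x)

  representative-cong : ∀ {i y γ δ} → γ Γ.≈ δ → element i y γ ≈ᴱ element i y δ
  representative-cong γ≈δ = Equivalence.from ≈ᴱ⇔
    (refl , _ , ∋-root _ , Equivalence.from (∋⇔reach _) (stop (Vertex.refl , Γ.sym γ≈δ)))

-- The action and the symmetry type graph

module CosetPolytope (em : ∀ {ℓ} → ExcludedMiddle ℓ) {v ℓv d ℓd c ℓ : Level} {n : ℕ}
                     {X : ColouredGraph n v ℓv d ℓd}
                     (premaniplex : IsPremaniplex X) {Γ : Group c ℓ} (V : VoltageAssignment X Γ)
                     (maniplex : IsManiplex (derivedGraph V))
                     (intersection : Derived.IntervalIntersection premaniplex V maniplex)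
                     (f : BaseVertices X) (Ws : BasePaths f) where
  open ColouredGraph X
  open CosetFaces premaniplex V maniplex f Ws
  open FlagGraph flagGraph hiding (r; r-cong; r-involutive; r-commute)
  open CosetPoset V f Ws hiding (cosetPoset; rightMultiplication)
  open Γ using (_∙_; _⁻¹; ε)
  open Polytopality em (isPolytopal intersection) isFacePoset hiding (isPolytope) public
  open Flags (cosetPoset V f Ws)
  open RawRelation (cosetPoset V f Ws) using () renaming (_≈_ to _≈±_; _∼_ to _≤±_)

  private
    _·_ : Element ± → Γ.Carrier → Element ±
    _·_ = rightMultiplication V f Ws

  isPolytope : IsPolytope n (cosetPoset V f Ws)
  isPolytope = Polytopality.isPolytope em (isPolytopal intersection) isFacePoset

  private
    module Poset = IsPartialOrder (IsPolytope.isPartialOrder isPolytope)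

  ·-cong : ∀ g {u w} → u ≈± w → (u · g) ≈± (w · g)
  ·-cong g AddEquality.⊥±≈⊥±   = AddEquality.⊥±≈⊥±
  ·-cong g AddEquality.[ A≈B ] = AddEquality.[ translate-cong g A≈B ]
  ·-cong g AddEquality.⊤±≈⊤±   = AddEquality.⊤±≈⊤±

  ·-mono : ∀ g {u w} → u ≤± w → (u · g) ≤± (w · g)
  ·-mono g AddOrder.⊥±≤⊥±        = AddOrder.⊥±≤⊥±
  ·-mono g AddOrder.⊥±≤[ A ]     = AddOrder.⊥±≤_ _ _
  ·-mono g AddOrder.[ inj₁ A<B ] = AddOrder.[ inj₁ (translate-mono g A<B) ]
  ·-mono g AddOrder.[ inj₂ A≈B ] = AddOrder.[ inj₂ (translate-cong g A≈B) ]
  ·-mono g AddOrder.⊥±≤⊤±        = AddOrder._≤⊤± _ _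
  ·-mono g AddOrder.[ A ]≤⊤±     = AddOrder._≤⊤± _ _
  ·-mono g AddOrder.⊤±≤⊤±        = AddOrder._≤⊤± _ _

  ·-congˡ : ∀ {u g h} → g Γ.≈ h → (u · g) ≈± (u · h)
  ·-congˡ {⊥±}    g≈h = AddEquality.⊥±≈⊥±
  ·-congˡ {[ A ]} g≈h = AddEquality.[ representative-cong (Γ.∙-congˡ g≈h) ]
  ·-congˡ {⊤±}    g≈h = AddEquality.⊤±≈⊤±

  ·-identity : ∀ u → (u · ε) ≈± u
  ·-identity ⊥±    = AddEquality.⊥±≈⊥±
  ·-identity [ A ] = AddEquality.[ representative-cong (Γ.identityʳ _) ]
  ·-identity ⊤±    = AddEquality.⊤±≈⊤±

  ·-assoc : ∀ u g h → (u · (g ∙ h)) ≈± ((u · g) · h)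
  ·-assoc ⊥±    g h = AddEquality.⊥±≈⊥±
  ·-assoc [ A ] g h = AddEquality.[ representative-cong (Γ.sym (Γ.assoc _ _ _)) ]
  ·-assoc ⊤±    g h = AddEquality.⊤±≈⊤±

  ·-cancel : ∀ u {g h} → g ∙ h Γ.≈ ε → ((u · g) · h) ≈± u
  ·-cancel u {g} {h} gh≈ε = Poset.Eq.trans (Poset.Eq.sym (·-assoc u g h))
    (Poset.Eq.trans (·-congˡ {u} gh≈ε) (·-identity u))

  isAutomorphism : ∀ g → IsOrderIsomorphism _≈±_ _≈±_ _≤±_ _≤±_ (_· g)
  isAutomorphism g = record
    { isOrderMonomorphism = record
      { isOrderHomomorphism = record { cong = ·-cong g ; mono = ·-mono g }
      ; injective = λ {u} {w} eq → Poset.Eq.trans (Poset.Eq.sym (undo u))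
                                     (Poset.Eq.trans (·-cong (g ⁻¹) eq) (undo w))
      ; cancel    = λ {u} {w} le → Poset.≤-respˡ-≈ (undo u)
                                     (Poset.≤-respʳ-≈ (undo w) (·-mono (g ⁻¹) le))
      }
    ; surjective = λ u → u · (g ⁻¹) , λ eq →
        Poset.Eq.trans (·-cong g eq) (·-cancel u (Γ.inverseˡ g))
    }
    where
    undo : ∀ u → ((u · g) · (g ⁻¹)) ≈± u
    undo u = ·-cancel u (Γ.inverseʳ g)

  isAutomorphismGroup : IsAutomorphismGroup Γ (cosetPoset V f Ws) (rightMultiplication V f Ws)
  isAutomorphismGroup = record
    { isAutomorphism = isAutomorphism
    ; ·-congˡ        = λ {u} → ·-congˡ {u}
    ; ·-identity     = ·-identity
    ; ·-assoc        = ·-assoc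
    -- If `g` fixes the faces at `x`, then `x` and its translate share them all and so coincide;
    -- cancelling in the group coordinate gives `g`.
    ; faithful       = λ {g} fixed →
        let x = proj₁ Maniplex.connected
            x≈xg : x ≈ act x g
            x≈xg = reach-≈ (λ i → Faces.∋-connected (Faces.face i x) (Faces.face∋ i x)
              (Faces.∋-resp (AddEquality.[≈]-injective _ (fixed [ Faces.face i x ]))
                (∋-act (Faces.face i x) g (Faces.face∋ i x))))
        in ΓProps.identityʳ-unique _ _ (Γ.sym (proj₂ x≈xg))
    }

  onFlag-act : ∀ {x g u} → OnFlag x u → OnFlag (act x g) (u · g)
  onFlag-act {u = ⊥±}        _   = tt
  onFlag-act {g = g} {[ A ]} A∋x = ∋-act A g A∋x
  onFlag-act {u = ⊤±}        _   = tt

  onFlag-unact : ∀ {x g u} → OnFlag (act x g) (u · g) → OnFlag x u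
  onFlag-unact {x} {g} {u} on = onFlag-resp (·-cancel u (Γ.inverseʳ g))
    (flagOf-mono (Vertex.refl , ΓProps.//-rightDividesʳ _ _) {(u · g) · (g ⁻¹)}
      (onFlag-act {act x g} {g ⁻¹} {u · g} on))

  vertexOf : Flag → Vertex
  vertexOf Φ = proj₁ (point Φ)

  -- Translates of a point stay over the same vertex of `X`, and `Γ` is transitive on the points
  -- over each vertex.
  orbit⇔vertex : ∀ {Φ Ψ} → SameOrbit isPolytope isAutomorphismGroup Φ Ψ ⇔ vertexOf Φ ≈ᵥ vertexOf Ψ
  orbit⇔vertex {Φ} {Ψ} = mk⇔ to from
    where
    x = point Φ
    y = point Ψ

    to : SameOrbit isPolytope isAutomorphismGroup Φ Ψ → vertexOf Φ ≈ᵥ vertexOf Ψ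
    to (g , Φ⊆ , _) = proj₁ xg≈y
      where
      xg≈y : act x g ≈ y
      xg≈y = reach-≈ (λ i → Faces.∋-connected (translate (Faces.face i x) g)
        (∋-act (Faces.face i x) g (Faces.face∋ i x))
        (proj₁ (≈flagOf-point Ψ) (Φ⊆ {[ Faces.face i x ]}
          (proj₂ (≈flagOf-point Φ) {[ Faces.face i x ]} (Faces.face∋ i x)))))

    from : vertexOf Φ ≈ᵥ vertexOf Ψ → SameOrbit isPolytope isAutomorphismGroup Φ Ψ
    from x≈y = g ,
      (λ {u} u∈Φ → proj₂ (≈flagOf-point Ψ) (flagOf-mono xg≈y {u · g}
        (onFlag-act {x} {g} {u} (proj₁ (≈flagOf-point Φ) u∈Φ)))) ,
      (λ {u} ug∈Ψ → proj₂ (≈flagOf-point Φ) (onFlag-unact {x} {g} {u}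
        (flagOf-mono (≈-sym xg≈y) {u · g} (proj₁ (≈flagOf-point Ψ) ug∈Ψ))))
      where
      g = proj₂ x ⁻¹ ∙ proj₂ y

      xg≈y : act x g ≈ y
      xg≈y = x≈y , ΓProps.\\-leftDividesˡ _ _

  symmetryTypeGraph≅ : symmetryTypeGraph isPolytope isAutomorphismGroup ≅ X
  symmetryTypeGraph≅ = record
    { onVertices = record
      { to        = vertexOf
      ; cong      = λ {Φ} {Ψ} → Equivalence.to (orbit⇔vertex {Φ} {Ψ})
      ; bijective = (λ {Φ} {Ψ} → Equivalence.from (orbit⇔vertex {Φ} {Ψ})) ,
          λ x → flagOf (x , ε) , λ {Φ} eq →
            Vertex.trans (Equivalence.to (orbit⇔vertex {Φ} {flagOf (x , ε)}) eq) (vertexOf-flagOf (x , ε))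
      }
    ; onDarts = record
      -- On both sides a dart is determined by its initial vertex and its colour.
      { to        = λ (Φ , i) → dartAt (vertexOf Φ) i
      ; cong      = λ { {Φ , i} {Ψ , _} (Φ~Ψ , refl) → ≈dartAt
          (Vertex.trans (init-dartAt _ i) (Equivalence.to (orbit⇔vertex {Φ} {Ψ}) Φ~Ψ)) (colour-dartAt _ i) }
      ; bijective =
          (λ {(Φ , i)} {(Ψ , j)} eq →
            Equivalence.from (orbit⇔vertex {Φ} {Ψ}) (Vertex.trans (Vertex.sym (init-dartAt _ i))
              (Vertex.trans (init-cong eq) (init-dartAt _ j))) ,
            trans (sym (colour-dartAt _ i)) (trans (colour-cong eq) (colour-dartAt _ j))) ,
          λ e → (flagOf (init e , ε) , colour e) , λ { {Φ , _} (Φ~ , refl) → Dart.sym (≈dartAt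
            (Vertex.sym (Vertex.trans (Equivalence.to (orbit⇔vertex {Φ} {flagOf (init e , ε)}) Φ~)
                                      (vertexOf-flagOf (init e , ε)))) refl) }
      }
    ; preserves-init   = λ (Φ , i) → init-dartAt (vertexOf Φ) i
    -- The flag adjacent to `Φ` is by construction `flagOf (r i (point Φ))`, and `r i` follows the
    -- dart of colour `i`.
    ; preserves-term   = λ (Φ , i) → Vertex.sym (vertexOf-flagOf (r i (point Φ)))
    ; preserves-inv    = λ (Φ , i) → ≈dartAt
        (Vertex.trans (init-inv _) (Vertex.sym (vertexOf-flagOf (r i (point Φ)))))
        (trans (colour-inv _) (colour-dartAt _ i))
    ; preserves-colour = λ (Φ , i) → colour-dartAt (vertexOf Φ) i
    }
    where
    vertexOf-flagOf : ∀ x → vertexOf (flagOf x) ≈ᵥ proj₁ x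
    vertexOf-flagOf x = proj₁ (point-flagOf x)

theorem4p4 : (∀ {ℓ} → ExcludedMiddle ℓ) →
    ∀ {v ℓv d ℓd c ℓ} (n : ℕ) (X : ColouredGraph n v ℓv d ℓd) → IsPremaniplex X →
    (Γ : Group c ℓ) (ξ : VoltageAssignment X Γ) → IsManiplex (derivedGraph ξ) →
    (∀ (k m : Fin n) x y →
    Voltages ξ (interval 0 (toℕ m)) x y ∩ Voltages ξ (interval (toℕ k) (n ∸ 1)) x y
    ≐ Voltages ξ (interval (toℕ k) (toℕ m)) x y) →
    (f : BaseVertices X) (W : BasePaths f) →
    Σ (IsPolytope n (cosetPoset ξ f W)) λ polytope →
    Σ (IsAutomorphismGroup Γ (cosetPoset ξ f W) (rightMultiplication ξ f W)) λ action →
    symmetryTypeGraph polytope action ≅ X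
theorem4p4 em n X premaniplex Γ ξ maniplex intersection f W =
  isPolytope , isAutomorphismGroup , symmetryTypeGraph≅
  where open CosetPolytope em premaniplex ξ maniplex intersection f W
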